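{- For every real number $p$ with $0 \leq p \leq \frac{1}{2}$, there is a many-one degree $\mathbf{a}$ such that $\Gamma_m(\mathbf{a}) = p$.
   Context: For $Z \subseteq \omega$, the lower density of $Z$ is $\underline{\rho}(Z) := \liminf_{n \to \infty} \frac{|Z \cap [0,n)|}{n}$. For sets $A, R \subseteq \omega$, let $A \leftrightarrow R := \{ x \mid x \in A \Longleftrightarrow x \in R \}$ be the set on which $A$ and $R$ agree. The coarse computability bound of a set $A \subseteq \omega$ is $\gamma(A) := \sup\{\underline{\rho}(A \leftrightarrow R) \mid R \subseteq \omega \text{ computable}\}$. For a many-one degree $\mathbf{a}$ (an equivalence class of subsets of $\omega$ under mutual many-one reducibility $\leq_m$), its coarse computability bound is $\Gamma_m(\mathbf{a}) := \inf\{\gamma(A) \mid A \leq_m \mathbf{a}\}$, where $A \leq_m \mathbf{a}$ means $A$ is many-one reducible to some (equivalently every) set in $\mathbf{a}$. -}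

module Defs where

open import Data.Bool using (Bool; true; false; if_then_else_; _≟_)
open import Data.Fin using (Fin)
open import Data.Integer as ℤ using (+_)
import Data.Integer.Properties as ℤ
open import Data.Nat as ℕ using (ℕ; zero; suc)
import Data.Nat.Properties as ℕ
open import Data.Product using (∃; _×_; _,_)
open import Data.Rational as ℚ using (ℚ; 0ℚ; 1ℚ)
import Data.Rational.Properties as ℚ
open import Data.Rational.Unnormalised as ℚᵘ using (mkℚᵘ)
import Data.Rational.Unnormalised.Properties as ℚᵘ
open import Data.Vec using (Vec; []; _∷_; lookup)
open import Function using (_⇔_; Equivalence)
open import Level using (0ℓ)
open import Relation.Binary.PropositionalEquality using (_≡_; refl)
open import Relation.Nullary using (does)
open import Relation.Unary using (Pred; _∈_; _∉_; _⊆_)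

-- The notions below are meant to be read classically: results about them
-- assume ExcludedMiddle explicitly.

-- Real numbers as lower Dedekind cuts: the real x is the set of rationals
-- strictly below it.  No locatedness is required, so these are the usual
-- reals under excluded middle (constructively they are only the lower reals).

record ℝ : Set₁ where
  field
    below     : Pred ℚ 0ℓ
    inhabited : ∃ λ q → q ∈ below
    proper    : ∃ λ q → q ∉ below
    downward  : ∀ {q r} → q ℚ.< r → r ∈ below → q ∈ below
    rounded   : ∀ {q} → q ∈ below → ∃ λ r → q ℚ.< r × r ∈ below

open ℝ public

infix 4 _≤_ _≃_

_≤_ : ℝ → ℝ → Set
x ≤ y = below x ⊆ below y

_≃_ : ℝ → ℝ → Set
x ≃ y = x ≤ y × y ≤ x

fromℚ : ℚ → ℝ
fromℚ p = record
  { below     = λ q → q ℚ.< p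
  ; inhabited = p ℚ.- 1ℚ , p-1<p
  ; proper    = p , ℚ.<-irrefl refl
  ; downward  = ℚ.<-trans
  ; rounded   = λ q<p → let (m , q<m , m<p) = ℚ.<-dense q<p in m , q<m , m<p
  }
  where
  p-1<p : p ℚ.- 1ℚ ℚ.< p
  p-1<p = ℚ.<-≤-trans (ℚ.+-monoʳ-< p (ℚ.negative⁻¹ (ℚ.- 1ℚ)))
                      (ℚ.≤-reflexive (ℚ.+-identityʳ p))

fromℚ-mono : ∀ {p q} → p ℚ.≤ q → fromℚ p ≤ fromℚ q
fromℚ-mono p≤q r<p = ℚ.<-≤-trans r<p p≤q

BoundedAbove BoundedBelow : {I : Set} → (I → ℝ) → Set₁
BoundedAbove x = ∃ λ b → ∀ i → x i ≤ b
BoundedBelow x = ∃ λ b → ∀ i → b ≤ x i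

-- Supremum and infimum of a bounded family; the first explicit argument
-- witnesses that the family is nonempty.

sup : {I : Set} → I → (x : I → ℝ) → BoundedAbove x → ℝ
sup i₀ x (b , x≤b) = record
  { below     = λ q → ∃ λ i → q ∈ below (x i)
  ; inhabited = let (q , q∈) = inhabited (x i₀) in q , i₀ , q∈
  ; proper    = let (q , q∉) = proper b in q , λ (i , q∈) → q∉ (x≤b i q∈)
  ; downward  = λ q<r (i , r∈) → i , downward (x i) q<r r∈
  ; rounded   = λ (i , q∈) → let (r , q<r , r∈) = rounded (x i) q∈ in r , q<r , i , r∈
  }

-- The intersection of the cuts may have a largest element, which is removed.

inf : {I : Set} → I → (x : I → ℝ) → BoundedBelow x → ℝ
inf i₀ x (b , b≤x) = record
  { below     = λ q → ∃ λ r → q ℚ.< r × (∀ i → r ∈ below (x i))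
  ; inhabited = let (q , q∈)       = inhabited b
                    (r , q<r , r∈) = rounded b q∈
                in q , r , q<r , λ i → b≤x i r∈
  ; proper    = let (q , q∉) = proper (x i₀)
                in q , λ (r , q<r , r∈) → q∉ (downward (x i₀) q<r (r∈ i₀))
  ; downward  = λ q<r (s , r<s , s∈) → s , ℚ.<-trans q<r r<s , s∈
  ; rounded   = λ (r , q<r , r∈) → let (m , q<m , m<r) = ℚ.<-dense q<r
                                   in m , q<m , r , m<r , r∈
  }

sup-upper : {I : Set} (i₀ : I) (x : I → ℝ) (b : BoundedAbove x) →
            ∀ i → x i ≤ sup i₀ x b
sup-upper i₀ x b i q∈ = i , q∈

sup-least : {I : Set} (i₀ : I) (x : I → ℝ) (b : BoundedAbove x) →
            ∀ y → (∀ i → x i ≤ y) → sup i₀ x b ≤ y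
sup-least i₀ x b y x≤y (i , q∈) = x≤y i q∈

inf-lower : {I : Set} (i₀ : I) (x : I → ℝ) (b : BoundedBelow x) →
            ∀ i → inf i₀ x b ≤ x i
inf-lower i₀ x b i (r , q<r , r∈) = downward (x i) q<r (r∈ i)

inf-greatest : {I : Set} (i₀ : I) (x : I → ℝ) (b : BoundedBelow x) →
               ∀ y → (∀ i → y ≤ x i) → y ≤ inf i₀ x b
inf-greatest i₀ x b y y≤x q∈ =
  let (r , q<r , r∈) = rounded y q∈ in r , q<r , λ i → y≤x i r∈

liminf : (x : ℕ → ℝ) → BoundedBelow x → BoundedAbove x → ℝ
liminf x (lo , lo≤x) (hi , x≤hi) = sup 0 tailInf (hi , tailInf≤hi)
  where
  tailInf : ℕ → ℝ
  tailInf N = inf 0 (λ k → x (N ℕ.+ k)) (lo , λ k → lo≤x (N ℕ.+ k))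

  tailInf≤hi : ∀ N → tailInf N ≤ hi
  tailInf≤hi N q∈ =
    x≤hi (N ℕ.+ 0) (inf-lower 0 (λ k → x (N ℕ.+ k)) (lo , λ k → lo≤x (N ℕ.+ k)) 0 q∈)

-- Subsets of ω are given by characteristic functions; under excluded middle
-- this is every subset, whether computable or not.

Subset : Set
Subset = ℕ → Bool

agree : Subset → Subset → Subset
agree A R x = does (A x ≟ R x)

indicator : Subset → ℕ → ℕ
indicator Z x = if Z x then 1 else 0

-- count Z n is |Z ∩ [0,n)|.

count : Subset → ℕ → ℕ
count Z zero    = 0
count Z (suc n) = indicator Z n ℕ.+ count Z n

count≤ : ∀ Z n → count Z n ℕ.≤ n
count≤ Z zero    = ℕ.z≤n
count≤ Z (suc n) = ℕ.+-mono-≤ (indicator≤1 (Z n)) (count≤ Z n)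
  where
  indicator≤1 : ∀ b → (if b then 1 else 0) ℕ.≤ 1
  indicator≤1 true  = ℕ.s≤s ℕ.z≤n
  indicator≤1 false = ℕ.z≤n

-- The frequency on [0,n+1), so that the denominator is never zero.

frequency : Subset → ℕ → ℚ
frequency Z n = (+ count Z (suc n)) ℚ./ suc n

0≤frequency : ∀ Z n → 0ℚ ℚ.≤ frequency Z n
0≤frequency Z n =
  ℚ.nonNegative⁻¹ (frequency Z n) {{ℚ.normalize-nonNeg (count Z (suc n)) (suc n)}}

frequency≤1 : ∀ Z n → frequency Z n ℚ.≤ 1ℚ
frequency≤1 Z n = ℚ.toℚᵘ-cancel-≤
  (ℚᵘ.≤-respˡ-≃ (ℚᵘ.≃-sym (ℚ.toℚᵘ-fromℚᵘ (mkℚᵘ (+ count Z (suc n)) n)))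
    (ℚᵘ.*≤* (ℤ.≤-trans
      (ℤ.*-monoʳ-≤-nonNeg (+ 1) (ℤ.+≤+ (count≤ Z (suc n))))
      (ℤ.≤-reflexive (ℤ.*-comm (+ suc n) (+ 1))))))

lowerDensity : Subset → ℝ
lowerDensity Z = liminf (λ n → fromℚ (frequency Z n))
  (fromℚ 0ℚ , λ n → fromℚ-mono (0≤frequency Z n))
  (fromℚ 1ℚ , λ n → fromℚ-mono (frequency≤1 Z n))

0≤lowerDensity : ∀ Z → fromℚ 0ℚ ≤ lowerDensity Z
0≤lowerDensity Z q<0 =
  0 , inf-greatest 0 (λ n → fromℚ (frequency Z n))
        (fromℚ 0ℚ , λ n → fromℚ-mono (0≤frequency Z n))
        (fromℚ 0ℚ) (λ n → fromℚ-mono (0≤frequency Z n)) q<0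

lowerDensity≤1 : ∀ Z → lowerDensity Z ≤ fromℚ 1ℚ
lowerDensity≤1 Z (N , r , q<r , r∈) =
  ℚ.<-trans q<r (ℚ.<-≤-trans (r∈ 0) (frequency≤1 Z (N ℕ.+ 0)))

-- Kleene's μ-recursive functions; Rec n codes n-ary partial functions.

data Rec : ℕ → Set where
  zer  : ∀ {n} → Rec n
  succ : Rec 1
  proj : ∀ {n} → Fin n → Rec n
  comp : ∀ {m n} → Rec m → Vec (Rec n) m → Rec n
  prec : ∀ {n} → Rec n → Rec (suc (suc n)) → Rec (suc n)
  mu   : ∀ {n} → Rec (suc n) → Rec n

infix 4 _[_]⇓_ _[_]⇓*_

mutual
  data _[_]⇓_ : ∀ {n} → Rec n → Vec ℕ n → ℕ → Set where
    zer⇓  : ∀ {n} {xs : Vec ℕ n} → zer [ xs ]⇓ 0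
    succ⇓ : ∀ {x} → succ [ x ∷ [] ]⇓ suc x
    proj⇓ : ∀ {n} {xs : Vec ℕ n} {i} → proj i [ xs ]⇓ lookup xs i
    comp⇓ : ∀ {m n} {f : Rec m} {gs : Vec (Rec n) m} {xs ys z} →
            gs [ xs ]⇓* ys → f [ ys ]⇓ z → comp f gs [ xs ]⇓ z
    prec-zero⇓ : ∀ {n} {f : Rec n} {g xs y} →
                 f [ xs ]⇓ y → prec f g [ 0 ∷ xs ]⇓ y
    prec-suc⇓  : ∀ {n} {f : Rec n} {g k xs y z} →
                 prec f g [ k ∷ xs ]⇓ y → g [ k ∷ y ∷ xs ]⇓ z →
                 prec f g [ suc k ∷ xs ]⇓ z
    mu⇓   : ∀ {n} {f : Rec (suc n)} {xs k} →
            (∀ {i} → i ℕ.< k → ∃ λ v → f [ i ∷ xs ]⇓ suc v) →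
            f [ k ∷ xs ]⇓ 0 → mu f [ xs ]⇓ k

  data _[_]⇓*_ {n} : ∀ {m} → Vec (Rec n) m → Vec ℕ n → Vec ℕ m → Set where
    []  : ∀ {xs} → [] [ xs ]⇓* []
    _∷_ : ∀ {m g} {gs : Vec (Rec n) m} {xs y ys} →
          g [ xs ]⇓ y → gs [ xs ]⇓* ys → (g ∷ gs) [ xs ]⇓* (y ∷ ys)

Computable : (ℕ → ℕ) → Set
Computable f = ∃ λ (e : Rec 1) → ∀ x → e [ x ∷ [] ]⇓ f x

ComputableSet : Subset → Set
ComputableSet R = Computable (indicator R)

-- The coarse computability bound.  The empty set witnesses that the family of
-- computable sets is nonempty.

γ : Subset → ℝ
γ A = sup {∃ ComputableSet} ((λ _ → false) , zer , λ _ → zer⇓)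
  (λ (R , _) → lowerDensity (agree A R))
  (fromℚ 1ℚ , λ (R , _) → lowerDensity≤1 (agree A R))

0≤γ : ∀ A → fromℚ 0ℚ ≤ γ A
0≤γ A q<0 =
  ((λ _ → false) , zer , λ _ → zer⇓) , 0≤lowerDensity (agree A (λ _ → false)) q<0

infix 4 _≤ₘ_ _≡ₘ_ _≤ₘᵈ_

_≤ₘ_ : Subset → Subset → Set
A ≤ₘ B = ∃ λ f → Computable f × (∀ x → A x ≡ B (f x))

_≡ₘ_ : Subset → Subset → Set
A ≡ₘ B = A ≤ₘ B × B ≤ₘ A

≤ₘ-refl : ∀ {A} → A ≤ₘ A
≤ₘ-refl = (λ x → x) , (proj Fin.zero , λ _ → proj⇓) , λ _ → refl

record ManyOneDegree : Set₁ where
  field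
    class     : Pred Subset 0ℓ
    rep       : Subset
    class-def : ∀ A → A ∈ class ⇔ A ≡ₘ rep

open ManyOneDegree public

_≤ₘᵈ_ : Subset → ManyOneDegree → Set
A ≤ₘᵈ a = ∃ λ B → B ∈ class a × A ≤ₘ B

rep≤ₘᵈ : ∀ a → rep a ≤ₘᵈ a
rep≤ₘᵈ a = rep a , Equivalence.from (class-def a (rep a)) (≤ₘ-refl , ≤ₘ-refl) , ≤ₘ-refl

Γₘ : ManyOneDegree → ℝ
Γₘ a = inf {∃ (_≤ₘᵈ a)} (rep a , rep≤ₘᵈ a) (λ (A , _) → γ A) (fromℚ 0ℚ , λ (A , _) → 0≤γ A)

{-# OPTIONS --safe #-}

-- Let R₀, R₁, ... list the computable sets, each infinitely often, let D agree
-- with R_k on the k-th of a sequence of rapidly growing intervals, and let π_y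
-- be rationals converging to p from below.  If each A(y) agreed with D(y)
-- independently with probability π_y, then γ(A) ≤ p by the law of large numbers
-- on these intervals.  Conversely, for a computable f let R(x) be the parity of
-- the number of x' < x with f(x') = f(x).  Two successive visits of f to the
-- same y give one agreement of R with f⁻¹(A), and the last visit to y, if
-- unpaired, gives one with probability π_y or 1 - π_y, which is at least π_y
-- because p ≤ 1/2.  So γ(f⁻¹(A)) ≥ p, again by the law of large numbers.
--
-- The random choice is replaced by a greedy one.  The laws of large numbers
-- needed are countably many statements s_ij = o(n_j), where n_j = (j + 1)⁴ and
-- s_ij sums the deviations [A(y) = D(y)] - π_y, up to sign, over at most n_j
-- places y.  Choosing each A(y) so that its deviation is opposite in sign to
-- the cross term keeps the energy Σ_j w_j Σ_{i ≤ j} s_ij² bounded by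
-- Σ_j w_j (j + 1) n_j, which is at most 1 for suitable weights w_j for which
-- 1 / w_j is still o(n_j²).

module Submission where

open import Defs
open import Axiom.ExcludedMiddle using (ExcludedMiddle)
open import Data.Bool as Bool using (Bool; true; false; if_then_else_; _xor_; not)
import Data.Bool.Properties as Bool
open import Data.Fin using (zero; suc)
open import Data.Integer as ℤ using (+_; -[1+_])
import Data.Integer.Properties as ℤ
open import Data.List as List using (List; []; _∷_; _++_; length)
open import Data.List.Membership.Propositional using () renaming (_∈_ to _∈ᴸ_)
open import Data.List.Membership.Propositional.Properties using (∈-++⁺ˡ; ∈-++⁺ʳ; ∈-map⁺; ∈-concatMap⁺; ∈-cartesianProductWith⁺; ∈-allFin; ∈-upTo⁺)
open import Data.List.Relation.Unary.Any as Any using (here; there)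
open import Data.Nat as ℕ using (ℕ; zero; suc)
import Data.Nat.Properties as ℕ
open import Data.Nat.Tactic.RingSolver as ℕ-Solver using ()
open import Data.Product using (∃; _×_; _,_; proj₁; proj₂)
open import Data.Rational as ℚ using (ℚ; mkℚ; 0ℚ; 1ℚ; ½; _+_; _*_; _-_; -_; _/_; _<_; toℚᵘ; positive; nonNegative; nonPositive)
open import Data.Rational.Properties
open import Data.Rational.Unnormalised as ℚᵘ using (mkℚᵘ)
import Data.Rational.Unnormalised.Properties as ℚᵘ
open import Data.Sum using (_⊎_; inj₁; inj₂)
open import Data.Unit using (tt)
open import Data.Vec using (Vec; []; _∷_)
open import Function using (mk⇔)
open import Level using (0ℓ)
open import Relation.Binary.Definitions using (tri<; tri≈; tri>)
open import Relation.Binary.PropositionalEquality using (_≡_; _≢_; _≗_; refl; sym; trans; cong; cong₂; subst; subst₂; module ≡-Reasoning)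
open import Relation.Nullary using (¬_; Dec; yes; no; contradiction)
open import Relation.Nullary.Decidable using (does; dec⇒maybe; from-yes; decidable-stable)
open import Relation.Unary using (_∈_; _∉_)
open import Tactic.RingSolver using (solve-∀)
open import Tactic.RingSolver.Core.AlmostCommutativeRing using (AlmostCommutativeRing; fromCommutativeRing)

-- Enumeration of the total recursive functions

mutual
  ⇓-deterministic : ∀ {n} {e : Rec n} {xs a b} → e [ xs ]⇓ a → e [ xs ]⇓ b → a ≡ b
  ⇓-deterministic zer⇓ zer⇓ = refl
  ⇓-deterministic succ⇓ succ⇓ = refl
  ⇓-deterministic proj⇓ proj⇓ = refl
  ⇓-deterministic (comp⇓ gs f) (comp⇓ gs′ f′) with refl ← ⇓*-deterministic gs gs′ = ⇓-deterministic f f′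
  ⇓-deterministic (prec-zero⇓ f) (prec-zero⇓ f′) = ⇓-deterministic f f′
  ⇓-deterministic (prec-suc⇓ r g) (prec-suc⇓ r′ g′) with refl ← ⇓-deterministic r r′ = ⇓-deterministic g g′
  ⇓-deterministic (mu⇓ {k = k} before f) (mu⇓ {k = k′} before′ f′) with ℕ.<-cmp k k′
  ... | tri≈ _ k≡k′ _ = k≡k′
  ... | tri< k<k′ _ _ with () ← ⇓-deterministic f (proj₂ (before′ k<k′))
  ... | tri> _ _ k′<k with () ← ⇓-deterministic f′ (proj₂ (before k′<k))

  ⇓*-deterministic : ∀ {m n} {gs : Vec (Rec n) m} {xs as bs} → gs [ xs ]⇓* as → gs [ xs ]⇓* bs → as ≡ bs
  ⇓*-deterministic [] [] = refl
  ⇓*-deterministic (g ∷ gs) (g′ ∷ gs′)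
    with refl ← ⇓-deterministic g g′ | refl ← ⇓*-deterministic gs gs′ = refl

vectors : {A : Set} → List A → ∀ m → List (Vec A m)
vectors xs zero    = [] ∷ []
vectors xs (suc m) = List.cartesianProductWith _∷_ xs (vectors xs m)

succs : ∀ n → List (Rec n)
succs 1 = succ ∷ []
succs _ = []

mutual
  codes : ℕ → ∀ n → List (Rec n)
  codes zero    n = []
  codes (suc d) n =
    zer ∷ succs n ++ List.map proj (List.allFin n) ++ comps d n ++ precs d n ++ List.map mu (codes d (suc n))

  comps : ℕ → ∀ n → List (Rec n)
  comps d n = List.concatMap (λ m → List.cartesianProductWith comp (codes d m) (vectors (codes d n) m)) (List.upTo d)

  precs : ℕ → ∀ n → List (Rec n)
  precs d zero    = []
  precs d (suc n) = List.cartesianProductWith prec (codes d n) (codes d (suc (suc n)))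

mutual
  -- The rank of a composition includes its intermediate arity `m`, so that a bound on the rank also
  -- bounds `m` and `comps` only has to search `List.upTo d`.
  rank : ∀ {n} → Rec n → ℕ
  rank zer              = 0
  rank succ             = 0
  rank (proj _)         = 0
  rank (comp {m} f gs)  = suc (m ℕ.+ (rank f ℕ.+ ranks gs))
  rank (prec f g)       = suc (rank f ℕ.+ rank g)
  rank (mu f)           = suc (rank f)

  ranks : ∀ {m n} → Vec (Rec n) m → ℕ
  ranks []       = 0
  ranks (g ∷ gs) = rank g ℕ.+ ranks gs

+-<-split : ∀ m n {d} → m ℕ.+ n ℕ.< d → m ℕ.< d × n ℕ.< d
+-<-split m n lt = ℕ.≤-<-trans (ℕ.m≤m+n m n) lt , ℕ.≤-<-trans (ℕ.m≤n+m n m) lt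

mutual
  ∈-codes : ∀ {n} (e : Rec n) {d} → rank e ℕ.< d → e ∈ᴸ codes d n
  ∈-codes zer (ℕ.s≤s _) = here refl
  ∈-codes succ (ℕ.s≤s _) = there (here refl)
  ∈-codes {n} (proj i) (ℕ.s≤s _) = there (∈-++⁺ʳ (succs n) (∈-++⁺ˡ (∈-map⁺ proj (∈-allFin i))))
  ∈-codes {n} (comp {m} f gs) {suc d} (ℕ.s≤s lt) =
    let m<d , rest = +-<-split m _ lt
        f<d , gs<d = +-<-split (rank f) _ rest
    in there (∈-++⁺ʳ (succs n) (∈-++⁺ʳ (List.map proj (List.allFin n)) (∈-++⁺ˡ
         (∈-concatMap⁺ _ (Any.map (λ { refl → ∈-cartesianProductWith⁺ comp (∈-codes f f<d) (∈-vectors gs gs<d) })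
                                  (∈-upTo⁺ m<d))))))
  ∈-codes {suc n} (prec f g) {suc d} (ℕ.s≤s lt) =
    let f<d , g<d = +-<-split (rank f) _ lt
    in there (∈-++⁺ʳ (succs (suc n)) (∈-++⁺ʳ (List.map proj (List.allFin (suc n))) (∈-++⁺ʳ (comps d (suc n))
         (∈-++⁺ˡ (∈-cartesianProductWith⁺ prec (∈-codes f f<d) (∈-codes g g<d))))))
  ∈-codes {n} (mu f) {suc d} (ℕ.s≤s lt) =
    there (∈-++⁺ʳ (succs n) (∈-++⁺ʳ (List.map proj (List.allFin n)) (∈-++⁺ʳ (comps d n)
      (∈-++⁺ʳ (precs d n) (∈-map⁺ mu (∈-codes f lt))))))

  ∈-vectors : ∀ {m n} (gs : Vec (Rec n) m) {d} → ranks gs ℕ.< d → gs ∈ᴸ vectors (codes d n) m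
  ∈-vectors [] _ = here refl
  ∈-vectors (g ∷ gs) lt =
    let g<d , gs<d = +-<-split (rank g) _ lt
    in ∈-cartesianProductWith⁺ _∷_ (∈-codes g g<d) (∈-vectors gs gs<d)

-- The concatenation of the lists codes (d + 1) 1, codes (d + 2) 1, ..., each
-- preceded by zer, with xs put in front.

stream : ℕ → List (Rec 1) → ℕ → Rec 1
stream d []       zero    = zer
stream d []       (suc k) = stream (suc d) (codes (suc d) 1) k
stream d (x ∷ xs) zero    = x
stream d (x ∷ xs) (suc k) = stream d xs k

stream-drop : ∀ d xs k → stream d xs (length xs ℕ.+ k) ≡ stream d [] k
stream-drop d []       k = refl
stream-drop d (x ∷ xs) k = stream-drop d xs k

stream-∈ : ∀ d {x xs} → x ∈ᴸ xs → ∃ λ k → stream d xs k ≡ x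
stream-∈ d (here refl) = 0 , refl
stream-∈ d (there x∈) = let k , eq = stream-∈ d x∈ in suc k , eq

enumerate : ℕ → Rec 1
enumerate = stream 0 []

enumerate-shift : ∀ d → ∃ λ s → d ℕ.≤ s × (∀ k → enumerate (s ℕ.+ k) ≡ stream d [] k)
enumerate-shift zero    = 0 , ℕ.z≤n , λ _ → refl
enumerate-shift (suc d) =
  let s , d≤s , eq = enumerate-shift d
      l = length (codes (suc d) 1)
  in s ℕ.+ suc l
   , ℕ.≤-trans (ℕ.s≤s (ℕ.≤-trans d≤s (ℕ.m≤m+n s l))) (ℕ.≤-reflexive (sym (ℕ.+-suc s l)))
   , λ k → trans (cong enumerate (ℕ.+-assoc s (suc l) k)) (trans (eq (suc l ℕ.+ k)) (stream-drop (suc d) (codes (suc d) 1) k))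

enumerate-recurrent : ∀ e K → ∃ λ k → K ℕ.≤ k × enumerate k ≡ e
enumerate-recurrent e K =
  -- This stage is late enough for its shift to be at least `K` and for the next list to contain
  -- `e`. The successor in `suc k` skips the separating `zer`.
  let d = K ℕ.+ rank e
      s , d≤s , eq = enumerate-shift d
      k , eq′ = stream-∈ (suc d) (∈-codes e (ℕ.s≤s (ℕ.m≤n+m (rank e) K)))
  in s ℕ.+ suc k , ℕ.≤-trans (ℕ.m≤m+n K (rank e)) (ℕ.≤-trans d≤s (ℕ.m≤m+n s (suc k))) , trans (eq (suc k)) eq′

Total : Rec 1 → Set
Total e = ∃ λ (f : ℕ → ℕ) → ∀ x → e [ x ∷ [] ]⇓ f x

-- A code that is not total gets the identity, so that every index yields a total function and hence
-- a meaningful requirement.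
valueOf : ∀ {e} → Dec (Total e) → ℕ → ℕ
valueOf (yes (f , _)) = f
valueOf (no _)        = λ x → x

valueOf-correct : ∀ {e} {f : ℕ → ℕ} (d : Dec (Total e)) → (∀ x → e [ x ∷ [] ]⇓ f x) → valueOf d ≗ f
valueOf-correct (yes (g , e⇓g)) e⇓f x = ⇓-deterministic (e⇓g x) (e⇓f x)
valueOf-correct (no ¬total)     e⇓f   = contradiction (_ , e⇓f) ¬total

module Enumeration (em : ExcludedMiddle 0ℓ) where

  φ : ℕ → ℕ → ℕ
  φ k = valueOf (em {Total (enumerate k)})

  -- Arbitrarily large indices are needed because the diagonal argument must meet a given set in
  -- blocks arbitrarily far out.
  φ-recurrent : ∀ f → Computable f → ∀ K → ∃ λ k → K ℕ.≤ k × φ k ≗ f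
  φ-recurrent f (e , e⇓f) K with k , K≤k , refl ← enumerate-recurrent e K =
    k , K≤k , valueOf-correct em e⇓f

-- Computability of the alternating set

predᶜ : Rec 1
predᶜ = prec zer (proj zero)

-- The arguments of monusᶜ are swapped, since prec recurses on the first one.

monusᶜ addᶜ distanceᶜ : Rec 2
monusᶜ    = prec (proj zero) (comp predᶜ (proj (suc zero) ∷ []))
addᶜ      = prec (proj zero) (comp succ (proj (suc zero) ∷ []))
distanceᶜ = comp addᶜ (comp monusᶜ (proj (suc zero) ∷ proj zero ∷ []) ∷ monusᶜ ∷ [])

predᶜ⇓ : ∀ n → predᶜ [ n ∷ [] ]⇓ ℕ.pred n
predᶜ⇓ zero    = prec-zero⇓ zer⇓
predᶜ⇓ (suc n) = prec-suc⇓ (predᶜ⇓ n) proj⇓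

monusᶜ⇓ : ∀ n m → monusᶜ [ n ∷ m ∷ [] ]⇓ m ℕ.∸ n
monusᶜ⇓ zero    m = prec-zero⇓ proj⇓
monusᶜ⇓ (suc n) m = subst (monusᶜ [ suc n ∷ m ∷ [] ]⇓_) (ℕ.pred[m∸n]≡m∸[1+n] m n)
  (prec-suc⇓ (monusᶜ⇓ n m) (comp⇓ (proj⇓ ∷ []) (predᶜ⇓ (m ℕ.∸ n))))

addᶜ⇓ : ∀ m n → addᶜ [ m ∷ n ∷ [] ]⇓ m ℕ.+ n
addᶜ⇓ zero    n = prec-zero⇓ proj⇓
addᶜ⇓ (suc m) n = prec-suc⇓ (addᶜ⇓ m n) (comp⇓ (proj⇓ ∷ []) succ⇓)

distance : ℕ → ℕ → ℕ
distance m n = (m ℕ.∸ n) ℕ.+ (n ℕ.∸ m)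

distanceᶜ⇓ : ∀ m n → distanceᶜ [ m ∷ n ∷ [] ]⇓ distance m n
distanceᶜ⇓ m n = comp⇓ (comp⇓ (proj⇓ ∷ proj⇓ ∷ []) (monusᶜ⇓ n m) ∷ monusᶜ⇓ m n ∷ []) (addᶜ⇓ (m ℕ.∸ n) (n ℕ.∸ m))

occursOdd : (ℕ → ℕ) → ℕ → ℕ → Bool
occursOdd f zero    y = false
occursOdd f (suc n) y = occursOdd f n y xor (f n ℕ.≡ᵇ y)

alternating : (ℕ → ℕ) → Subset
alternating f x = occursOdd f x (f x)

bit : Bool → ℕ
bit b = if b then 1 else 0

-- Together with `distance-bit` this expresses the equality test and exclusive or by `distance`, so
-- that `toggleᶜ` needs arithmetic only.
1∸distance : ∀ m n → 1 ℕ.∸ distance m n ≡ bit (m ℕ.≡ᵇ n)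
1∸distance zero    zero    = refl
1∸distance zero    (suc n) = ℕ.0∸n≡0 n
1∸distance (suc m) zero    = ℕ.0∸n≡0 (m ℕ.+ 0)
1∸distance (suc m) (suc n) = 1∸distance m n

distance-bit : ∀ a b → distance (bit a) (bit b) ≡ bit (a xor b)
distance-bit true  true  = refl
distance-bit true  false = refl
distance-bit false true  = refl
distance-bit false false = refl

toggleᶜ : Rec 1 → Rec 3
toggleᶜ e = comp distanceᶜ
  (proj (suc zero) ∷
   comp monusᶜ (comp distanceᶜ (comp e (proj zero ∷ []) ∷ proj (suc (suc zero)) ∷ []) ∷ comp succ (zer ∷ []) ∷ []) ∷ [])

occursOddᶜ : Rec 1 → Rec 2
occursOddᶜ e = prec zer (toggleᶜ e)

module _ (f : ℕ → ℕ) {e} (e⇓f : ∀ x → e [ x ∷ [] ]⇓ f x) where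

  toggleᶜ⇓ : ∀ k b y → toggleᶜ e [ k ∷ bit b ∷ y ∷ [] ]⇓ bit (b xor (f k ℕ.≡ᵇ y))
  toggleᶜ⇓ k b y = subst (toggleᶜ e [ k ∷ bit b ∷ y ∷ [] ]⇓_)
    (trans (cong (distance (bit b)) (1∸distance (f k) y)) (distance-bit b (f k ℕ.≡ᵇ y)))
    (comp⇓ (proj⇓ ∷
            comp⇓ (comp⇓ (comp⇓ (proj⇓ ∷ []) (e⇓f k) ∷ proj⇓ ∷ []) (distanceᶜ⇓ (f k) y) ∷ comp⇓ (zer⇓ ∷ []) succ⇓ ∷ [])
                  (monusᶜ⇓ (distance (f k) y) 1) ∷ [])
           (distanceᶜ⇓ (bit b) (1 ℕ.∸ distance (f k) y)))

  occursOddᶜ⇓ : ∀ n y → occursOddᶜ e [ n ∷ y ∷ [] ]⇓ bit (occursOdd f n y)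
  occursOddᶜ⇓ zero    y = prec-zero⇓ zer⇓
  occursOddᶜ⇓ (suc n) y = prec-suc⇓ (occursOddᶜ⇓ n y) (toggleᶜ⇓ n (occursOdd f n y) y)

alternating-computable : ∀ f → Computable f → ComputableSet (alternating f)
alternating-computable f (e , e⇓f) =
  comp (occursOddᶜ e) (proj zero ∷ e ∷ []) , λ x → comp⇓ (proj⇓ ∷ e⇓f x ∷ []) (occursOddᶜ⇓ f e⇓f x (f x))

≤ₘ-trans : ∀ {A B C} → A ≤ₘ B → B ≤ₘ C → A ≤ₘ C
≤ₘ-trans (f , (e , e⇓f) , A≡) (g , (e′ , e′⇓g) , B≡) =
  (λ x → g (f x)) , (comp e′ (e ∷ []) , λ x → comp⇓ (e⇓f x ∷ []) (e′⇓g (f x))) , λ x → trans (A≡ x) (B≡ (f x))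

-- Arithmetic and finite sums in ℚ

ℚ-ring : AlmostCommutativeRing 0ℓ 0ℓ
ℚ-ring = fromCommutativeRing +-*-commutativeRing (λ x → dec⇒maybe (0ℚ ≟ x))

+-nonNeg : ∀ {p q} → 0ℚ ℚ.≤ p → 0ℚ ℚ.≤ q → 0ℚ ℚ.≤ p + q
+-nonNeg = +-mono-≤

*-nonNeg : ∀ {p q} → 0ℚ ℚ.≤ p → 0ℚ ℚ.≤ q → 0ℚ ℚ.≤ p * q
*-nonNeg {p} {q} 0≤p 0≤q = nonNegative⁻¹ (p * q) {{nonNeg*nonNeg⇒nonNeg p {{nonNegative 0≤p}} q {{nonNegative 0≤q}}}}

square-nonNeg : ∀ p → 0ℚ ℚ.≤ p * p
square-nonNeg p with ≤-total 0ℚ p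
... | inj₁ 0≤p = *-nonNeg 0≤p 0≤p
... | inj₂ p≤0 = nonNegative⁻¹ (p * p) {{nonPos*nonPos⇒nonPos p {{nonPositive p≤0}} p {{nonPositive p≤0}}}}

gap : ∀ {p q} → p ℚ.≤ q → 0ℚ ℚ.≤ q - p
gap {p} {q} p≤q = subst (ℚ._≤ q - p) (+-inverseʳ p) (+-monoˡ-≤ (- p) p≤q)

-- Linear and polynomial inequalities are proved by exhibiting q - p as a
-- combination of terms that are known to be nonnegative.

≤-by : ∀ {p q} d → 0ℚ ℚ.≤ d → q ≡ p + d → p ℚ.≤ q
≤-by {p} {q} d 0≤d eq = subst₂ ℚ._≤_ (+-identityʳ p) (sym eq) (+-monoʳ-≤ p 0≤d)

*-monoˡ : ∀ {p q} r → 0ℚ ℚ.≤ r → p ℚ.≤ q → r * p ℚ.≤ r * q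
*-monoˡ r 0≤r = *-monoˡ-≤-nonNeg r {{nonNegative 0≤r}}

-- Recursion makes `ι (suc n)` unfold to `1ℚ + ι n`, a form to which ring identities apply directly.
ι : ℕ → ℚ
ι zero    = 0ℚ
ι (suc n) = 1ℚ + ι n

2ℚ : ℚ
2ℚ = 1ℚ + 1ℚ

0≤1 : 0ℚ ℚ.≤ 1ℚ
0≤1 = nonNegative⁻¹ 1ℚ

0≤2 : 0ℚ ℚ.≤ 2ℚ
0≤2 = +-nonNeg 0≤1 0≤1

0≤ι : ∀ n → 0ℚ ℚ.≤ ι n
0≤ι zero    = ≤-refl
0≤ι (suc n) = +-nonNeg 0≤1 (0≤ι n)

0<ι : ∀ n → 0ℚ < ι (suc n)
0<ι n = +-mono-<-≤ (positive⁻¹ 1ℚ) (0≤ι n)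

ι-+ : ∀ m n → ι (m ℕ.+ n) ≡ ι m + ι n
ι-+ zero    n = sym (+-identityˡ (ι n))
ι-+ (suc m) n = trans (cong (λ x → 1ℚ + x) (ι-+ m n)) (sym (+-assoc 1ℚ (ι m) (ι n)))

ι-* : ∀ m n → ι (m ℕ.* n) ≡ ι m * ι n
ι-* zero    n = sym (*-zeroˡ (ι n))
ι-* (suc m) n = trans (ι-+ n (m ℕ.* n)) (trans (cong (λ x → ι n + x) (ι-* m n)) (lemma (ι m) (ι n)))
  where
  lemma : ∀ x y → y + x * y ≡ (1ℚ + x) * y
  lemma = solve-∀ ℚ-ring

ι-mono : ∀ {m n} → m ℕ.≤ n → ι m ℚ.≤ ι n
ι-mono {m} {n} m≤n = ≤-by (ι (n ℕ.∸ m)) (0≤ι (n ℕ.∸ m)) (trans (cong ι (sym (ℕ.m+[n∸m]≡n m≤n))) (ι-+ m (n ℕ.∸ m)))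

toℚᵘ-ι : ∀ n → toℚᵘ (ι n) ℚᵘ.≃ mkℚᵘ (+ n) 0
toℚᵘ-ι zero    = ℚᵘ.≃-refl
toℚᵘ-ι (suc n) = ℚᵘ.≃-trans (toℚᵘ-homo-+ 1ℚ (ι n)) (ℚᵘ.≃-trans (ℚᵘ.+-congʳ (toℚᵘ 1ℚ) (toℚᵘ-ι n)) (ℚᵘ.*≡*
  (trans (ℤ.*-identityʳ _) (trans (cong (λ x → + 1 ℤ.+ x) (ℤ.*-identityʳ (+ n))) (sym (ℤ.*-identityʳ (+ suc n)))))))

/-*-ι : ∀ m n → (+ m / suc n) * ι (suc n) ≡ ι m
/-*-ι m n = toℚᵘ-injective
  (ℚᵘ.≃-trans (toℚᵘ-homo-* (+ m / suc n) (ι (suc n)))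
  (ℚᵘ.≃-trans (ℚᵘ.*-cong (toℚᵘ-fromℚᵘ (mkℚᵘ (+ m) n)) (toℚᵘ-ι (suc n)))
  (ℚᵘ.≃-trans (ℚᵘ.*≡* (trans (ℤ.*-identityʳ _) (cong (+ m ℤ.*_) (cong +_ (sym (ℕ.*-identityʳ (suc n)))))))
  (ℚᵘ.≃-sym (toℚᵘ-ι m)))))

Σ : ℕ → (ℕ → ℚ) → ℚ
Σ zero    g = 0ℚ
Σ (suc n) g = Σ n g + g n

Σ-mono : ∀ n {g h} → (∀ {i} → i ℕ.< n → g i ℚ.≤ h i) → Σ n g ℚ.≤ Σ n h
Σ-mono zero    g≤h = ≤-refl
Σ-mono (suc n) g≤h = +-mono-≤ (Σ-mono n (λ i<n → g≤h (ℕ.m<n⇒m<1+n i<n))) (g≤h ℕ.≤-refl)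

Σ-cong : ∀ n {g h} → (∀ i → g i ≡ h i) → Σ n g ≡ Σ n h
Σ-cong zero    g≡h = refl
Σ-cong (suc n) g≡h = cong₂ _+_ (Σ-cong n g≡h) (g≡h n)

Σ-+ : ∀ n g h → Σ n (λ i → g i + h i) ≡ Σ n g + Σ n h
Σ-+ zero    g h = refl
Σ-+ (suc n) g h = trans (cong (_+ (g n + h n)) (Σ-+ n g h)) (lemma (Σ n g) (Σ n h) (g n) (h n))
  where
  lemma : ∀ a b c d → a + b + (c + d) ≡ a + c + (b + d)
  lemma = solve-∀ ℚ-ring

Σ-* : ∀ n c g → Σ n (λ i → c * g i) ≡ c * Σ n g
Σ-* zero    c g = sym (*-zeroʳ c)
Σ-* (suc n) c g = trans (cong (_+ c * g n) (Σ-* n c g)) (sym (*-distribˡ-+ c (Σ n g) (g n)))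

Σ-const : ∀ n c → Σ n (λ _ → c) ≡ ι n * c
Σ-const zero    c = sym (*-zeroˡ c)
Σ-const (suc n) c = trans (cong (_+ c) (Σ-const n c)) (lemma (ι n) c)
  where
  lemma : ∀ a c → a * c + c ≡ (1ℚ + a) * c
  lemma = solve-∀ ℚ-ring

Σ-nonNeg : ∀ n {g} → (∀ i → 0ℚ ℚ.≤ g i) → 0ℚ ℚ.≤ Σ n g
Σ-nonNeg zero    0≤g = ≤-refl
Σ-nonNeg (suc n) 0≤g = +-nonNeg (Σ-nonNeg n 0≤g) (0≤g n)

term≤Σ : ∀ n {g i} → (∀ i → 0ℚ ℚ.≤ g i) → i ℕ.< n → g i ℚ.≤ Σ n g
term≤Σ (suc n) {g} {i} 0≤g i<1+n with i ℕ.≟ n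
... | yes refl = ≤-by (Σ n g) (Σ-nonNeg n 0≤g) (+-comm (Σ n g) (g n))
... | no i≢n   = ≤-trans (term≤Σ n 0≤g (ℕ.≤∧≢⇒< (ℕ.m<1+n⇒m≤n i<1+n) i≢n)) (≤-by (g n) (0≤g n) refl)

square-cancel-≤ : ∀ {p q} → 0ℚ ℚ.≤ q → p * p ℚ.≤ q * q → p ℚ.≤ q
square-cancel-≤ {p} {q} 0≤q p²≤q² = ≮⇒≥ λ q<p →
  <-irrefl refl (<-≤-trans (≤-<-trans (*-monoˡ q 0≤q (<⇒≤ q<p)) (*-monoˡ-<-pos p {{positive (≤-<-trans 0≤q q<p)}} q<p)) p²≤q²)

neg-square : ∀ p → - p * - p ≡ p * p
neg-square = solve-∀ ℚ-ring

opaque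

  inv : ℕ → ℚ
  inv n = + 1 / suc n

  inv-zero : inv 0 ≡ 1ℚ
  inv-zero = refl

  inv-*-ι : ∀ n → inv n * ι (suc n) ≡ 1ℚ
  inv-*-ι n = trans (/-*-ι 1 n) (+-identityʳ 1ℚ)

  0≤inv : ∀ n → 0ℚ ℚ.≤ inv n
  0≤inv n = nonNegative⁻¹ (inv n) {{normalize-nonNeg 1 (suc n)}}

-- Greedy balancing

level : ℕ → ℕ
level j = suc j ℕ.^ 4

ι-level : ∀ j → ι (level j) ≡ ι (suc j) * (ι (suc j) * (ι (suc j) * ι (suc j)))
ι-level j = trans (ι-* J (J ℕ.^ 3)) (cong (λ x → ι J * x) (trans (ι-* J (J ℕ.^ 2)) (cong (λ x → ι J * x)
  (trans (ι-* J (J ℕ.^ 1)) (cong (λ x → ι J * x) (cong ι (ℕ.*-identityʳ J)))))))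
  where J = suc j

-- The power of j + 1 and the factor j + 2 are chosen so that the budget
-- weight j * (j + 1) * level j of level j telescopes.

weight : ℕ → ℚ
weight j = c * c * c * (c * c * c) * inv (suc j)
  where c = inv j

0≤weight : ∀ j → 0ℚ ℚ.≤ weight j
0≤weight j = *-nonNeg (*-nonNeg c³ c³) (0≤inv (suc j))
  where c³ = *-nonNeg (*-nonNeg (0≤inv j) (0≤inv j)) (0≤inv j)

-- Level `j` has `suc j` requirements, each with budget `level j`, in all a fifth power. It cancels
-- five of the six factors `inv j` and leaves `inv j * inv (suc j)`, a difference of consecutive
-- reciprocals.
weight-level : ∀ j → weight j * (ι (suc j) * ι (level j)) ≡ inv j - inv (suc j)
weight-level j = trans (cong (λ x → weight j * (ι (suc j) * x)) (ι-level j)) (trans (lemma₁ (inv j) (inv (suc j)) (ι (suc j)))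
  (trans (cong (λ x → x * x * x * x * x * (inv j * inv (suc j))) (inv-*-ι j)) (trans (lemma₂ (inv j) (inv (suc j)) (ι (suc j)))
  (trans (cong₂ (λ x y → inv j * x - y * inv (suc j)) (inv-*-ι (suc j)) (inv-*-ι j)) (lemma₃ (inv j) (inv (suc j)))))))
  where
  lemma₁ : ∀ c d J → c * c * c * (c * c * c) * d * (J * (J * (J * (J * J)))) ≡ c * J * (c * J) * (c * J) * (c * J) * (c * J) * (c * d)
  lemma₁ = solve-∀ ℚ-ring
  lemma₂ : ∀ c d J → 1ℚ * 1ℚ * 1ℚ * 1ℚ * 1ℚ * (c * d) ≡ c * (d * (1ℚ + J)) - c * J * d
  lemma₂ = solve-∀ ℚ-ring
  lemma₃ : ∀ c d → c * 1ℚ - 1ℚ * d ≡ c - d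
  lemma₃ = solve-∀ ℚ-ring

-- The reciprocal of the weight has degree 7 in `j`, one less than the square of `level j`;
-- `discrepancy` lives on this margin.
weight-ι⁶ : ∀ j → let J = ι (suc j) in weight j * (J * J * J * (J * J * J) * ι (suc (suc j))) ≡ 1ℚ
weight-ι⁶ j = trans (lemma (inv j) (inv (suc j)) (ι (suc j)) (ι (suc (suc j))))
  (cong₂ (λ x y → x * x * x * x * x * x * y) (inv-*-ι j) (inv-*-ι (suc j)))
  where
  lemma : ∀ c d J K → c * c * c * (c * c * c) * d * (J * J * J * (J * J * J) * K) ≡ c * J * (c * J) * (c * J) * (c * J) * (c * J) * (c * J) * (d * K)
  lemma = solve-∀ ℚ-ring

weightedSum : ℕ → (ℕ → ℕ → ℚ) → ℚ
weightedSum y g = Σ y (λ j → weight j * Σ (suc j) (λ i → g i j))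

weightedSum-cong : ∀ y {g h} → (∀ i j → g i j ≡ h i j) → weightedSum y g ≡ weightedSum y h
weightedSum-cong y g≡h = Σ-cong y (λ j → cong (λ x → weight j * x) (Σ-cong (suc j) (λ i → g≡h i j)))

weightedSum-mono : ∀ y {g h} → (∀ {i j} → j ℕ.< y → g i j ℚ.≤ h i j) → weightedSum y g ℚ.≤ weightedSum y h
weightedSum-mono y g≤h = Σ-mono y (λ {j} j<y → *-monoˡ (weight j) (0≤weight j) (Σ-mono (suc j) (λ _ → g≤h j<y)))

weightedSum-+ : ∀ y g h → weightedSum y (λ i j → g i j + h i j) ≡ weightedSum y g + weightedSum y h
weightedSum-+ y g h = trans
  (Σ-cong y (λ j → trans (cong (λ x → weight j * x) (Σ-+ (suc j) (λ i → g i j) (λ i → h i j))) (*-distribˡ-+ (weight j) _ _)))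
  (Σ-+ y (λ j → weight j * Σ (suc j) (λ i → g i j)) (λ j → weight j * Σ (suc j) (λ i → h i j)))

weightedSum-* : ∀ y c g → weightedSum y (λ i j → c * g i j) ≡ c * weightedSum y g
weightedSum-* y c g = trans
  (Σ-cong y (λ j → trans (cong (λ x → weight j * x) (Σ-* (suc j) c (λ i → g i j))) (lemma (weight j) c _)))
  (Σ-* y c (λ j → weight j * Σ (suc j) (λ i → g i j)))
  where
  lemma : ∀ w c s → w * (c * s) ≡ c * (w * s)
  lemma = solve-∀ ℚ-ring

weightedSum-nonNeg : ∀ y {g} → (∀ i j → 0ℚ ℚ.≤ g i j) → 0ℚ ℚ.≤ weightedSum y g
weightedSum-nonNeg y 0≤g = Σ-nonNeg y (λ j → *-nonNeg (0≤weight j) (Σ-nonNeg (suc j) (λ i → 0≤g i j)))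

weightedTerm≤ : ∀ {y g i j} → (∀ i j → 0ℚ ℚ.≤ g i j) → i ℕ.≤ j → j ℕ.< y → weight j * g i j ℚ.≤ weightedSum y g
weightedTerm≤ {y} {g} {i} {j} 0≤g i≤j j<y = ≤-trans
  (*-monoˡ (weight j) (0≤weight j) (term≤Σ (suc j) (λ i → 0≤g i j) (ℕ.s≤s i≤j)))
  (term≤Σ y (λ j → *-nonNeg (0≤weight j) (Σ-nonNeg (suc j) (λ i → 0≤g i j))) j<y)

weightedSum-level : ∀ y → weightedSum y (λ i j → ι (level j)) ℚ.≤ 1ℚ
weightedSum-level y = ≤-trans (≤-reflexive (telescope y)) (≤-by (inv y) (0≤inv y) (lemma₂ (inv y)))
  where
  lemma₁ : ∀ c d → 1ℚ - c + (c - d) ≡ 1ℚ - d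
  lemma₁ = solve-∀ ℚ-ring
  lemma₂ : ∀ d → 1ℚ ≡ 1ℚ - d + d
  lemma₂ = solve-∀ ℚ-ring
  telescope : ∀ y → weightedSum y (λ i j → ι (level j)) ≡ 1ℚ - inv y
  telescope zero    = sym (cong (λ x → 1ℚ - x) inv-zero)
  telescope (suc y) = trans
    (cong₂ _+_ (telescope y) (trans (cong (λ x → weight y * x) (Σ-const (suc y) (ι (level y)))) (weight-level y)))
    (lemma₁ (inv y) (inv (suc y)))

-- The coefficient `δ i j y` is the one with which the deviation at `y` enters the sum of
-- requirement `(i , j)`.
module Balancing
  (δ : ℕ → ℕ → ℕ → ℚ) (π : ℕ → ℚ)
  (0≤π : ∀ y → 0ℚ ℚ.≤ π y) (π≤1 : ∀ y → π y ℚ.≤ 1ℚ)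
  (δ-early : ∀ i {j y} → y ℕ.< j → δ i j y ≡ 0ℚ)
  (δ-level : ∀ i j y → Σ y (λ x → δ i j x * δ i j x) ℚ.≤ ι (level j))
  where

  value : ℕ → Bool → ℚ
  value y b = (if b then 1ℚ else 0ℚ) - π y

  correlation : ℕ → (ℕ → ℕ → ℚ) → ℚ
  correlation y s = weightedSum (suc y) (λ i j → s i j * δ i j y)

  greedy : ℕ → (ℕ → ℕ → ℚ) → Bool
  greedy y s = does (correlation y s ≤? 0ℚ)

  state : ℕ → ℕ → ℕ → ℚ
  state zero    i j = 0ℚ
  state (suc y) i j = state y i j + δ i j y * value y (greedy y (state y))

  choice : ℕ → Bool
  choice y = greedy y (state y)

  deviation : ℕ → ℚ
  deviation y = value y (choice y)

  state-Σ : ∀ y i j → state y i j ≡ Σ y (λ x → δ i j x * deviation x)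
  state-Σ zero    i j = refl
  state-Σ (suc y) i j = cong (_+ δ i j y * deviation y) (state-Σ y i j)

  value²≤1 : ∀ y b → value y b * value y b ℚ.≤ 1ℚ
  value²≤1 y true  = ≤-by ((1ℚ + (1ℚ - π y)) * π y) (*-nonNeg (+-nonNeg 0≤1 (gap (π≤1 y))) (0≤π y)) (lemma (π y))
    where
    lemma : ∀ p → 1ℚ ≡ (1ℚ - p) * (1ℚ - p) + (1ℚ + (1ℚ - p)) * p
    lemma = solve-∀ ℚ-ring
  value²≤1 y false = ≤-by ((1ℚ - π y) * (1ℚ + π y)) (*-nonNeg (gap (π≤1 y)) (+-nonNeg 0≤1 (0≤π y))) (lemma (π y))
    where
    lemma : ∀ p → 1ℚ ≡ (0ℚ - p) * (0ℚ - p) + (1ℚ - p) * (1ℚ + p)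
    lemma = solve-∀ ℚ-ring

  -- The value of `true` is `1ℚ - π y`, which is nonnegative, and that of `false` is `0ℚ - π y`,
  -- which is nonpositive; so either sign of the correlation can be opposed.
  value-opposes : ∀ y {T} (T≤0? : Dec (T ℚ.≤ 0ℚ)) → value y (does T≤0?) * T ℚ.≤ 0ℚ
  value-opposes y {T} (yes T≤0) = ≤-by _ (*-nonNeg (gap (π≤1 y)) (gap T≤0)) (lemma (π y) T)
    where
    lemma : ∀ p T → 0ℚ ≡ (1ℚ - p) * T + (1ℚ - p) * (0ℚ - T)
    lemma = solve-∀ ℚ-ring
  value-opposes y {T} (no T≰0) = ≤-by _ (*-nonNeg (0≤π y) (<⇒≤ (≰⇒> T≰0))) (lemma (π y) T)
    where
    lemma : ∀ p T → 0ℚ ≡ (0ℚ - p) * T + p * T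
    lemma = solve-∀ ℚ-ring

  energy : ℕ → ℚ
  energy y = weightedSum y (λ i j → state y i j * state y i j)

  budget : ℕ → ℕ → ℕ → ℚ
  budget y i j = Σ y (λ x → δ i j x * δ i j x)

  state-early : ∀ i {j} y → y ℕ.≤ j → state y i j ≡ 0ℚ
  state-early i zero    _   = refl
  state-early i (suc y) y<j = trans
    (cong₂ (λ s d → s + d * deviation y) (state-early i y (ℕ.<⇒≤ y<j)) (δ-early i y<j))
    (trans (+-identityˡ _) (*-zeroˡ (deviation y)))

  -- The new requirements (i, y) have had no contribution before y, so they
  -- may be added for free before passing from y to y + 1.

  energy-extend : ∀ y → weightedSum (suc y) (λ i j → state y i j * state y i j) ≡ energy y
  energy-extend y = trans (cong (λ s → energy y + weight y * s) zeros) (lemma (energy y) (weight y))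
    where
    lemma : ∀ a w → a + w * 0ℚ ≡ a
    lemma = solve-∀ ℚ-ring
    zeros : Σ (suc y) (λ i → state y i y * state y i y) ≡ 0ℚ
    zeros = trans (Σ-cong (suc y) (λ i → cong₂ _*_ (state-early i y ℕ.≤-refl) (state-early i y ℕ.≤-refl)))
      (trans (Σ-const (suc y) 0ℚ) (*-zeroʳ (ι (suc y))))

  -- Expanding the squares, a step adds a multiple of the correlation, nonpositive by the greedy
  -- choice, and the weighted sum of the squares of `δ i j y` times a factor of at most 1.
  energy≤budget : ∀ y → energy y ℚ.≤ weightedSum y (budget y)
  energy≤budget zero    = ≤-refl
  energy≤budget (suc y) = begin
    weightedSum (suc y) (λ i j → state (suc y) i j * state (suc y) i j)
      ≡⟨ weightedSum-cong (suc y) (λ i j → lemma₁ (state y i j) (δ i j y) (deviation y)) ⟩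
    weightedSum (suc y) (λ i j → state y i j * state y i j + (2ℚ * deviation y * (state y i j * δ i j y) + deviation y * deviation y * (δ i j y * δ i j y)))
      ≡⟨ expand ⟩
    E + (2ℚ * deviation y * T + deviation y * deviation y * D)
      ≤⟨ ≤-by (2ℚ * (0ℚ - deviation y * T) + (1ℚ - deviation y * deviation y) * D)
           (+-nonNeg (*-nonNeg 0≤2 (gap (value-opposes y (T ≤? 0ℚ))))
                     (*-nonNeg (gap (value²≤1 y (choice y))) (weightedSum-nonNeg (suc y) (λ i j → square-nonNeg (δ i j y)))))
           (lemma₂ E (deviation y) T D) ⟩
    E + D
      ≡⟨ cong (_+ D) (energy-extend y) ⟩
    energy y + D
      ≤⟨ +-monoˡ-≤ D (energy≤budget y) ⟩
    weightedSum y (budget y) + D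
      -- Admitting the requirements of level `y` only adds nonnegative terms to the budget.
      ≤⟨ +-monoˡ-≤ D (≤-by {weightedSum y (budget y)} {weightedSum (suc y) (budget y)} _ (*-nonNeg (0≤weight y) (Σ-nonNeg (suc y) (λ i → Σ-nonNeg y (λ x → square-nonNeg (δ i y x))))) refl) ⟩
    weightedSum (suc y) (budget y) + D
      ≡⟨ sym (weightedSum-+ (suc y) (budget y) (λ i j → δ i j y * δ i j y)) ⟩
    weightedSum (suc y) (budget (suc y))
      ∎
    where
    open ≤-Reasoning
    E = weightedSum (suc y) (λ i j → state y i j * state y i j)
    T = correlation y (state y)
    D = weightedSum (suc y) (λ i j → δ i j y * δ i j y)
    lemma₁ : ∀ s d x → (s + d * x) * (s + d * x) ≡ s * s + (2ℚ * x * (s * d) + x * x * (d * d))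
    lemma₁ = solve-∀ ℚ-ring
    lemma₂ : ∀ E x T D → E + D ≡ E + (2ℚ * x * T + x * x * D) + (2ℚ * (0ℚ - x * T) + (1ℚ - x * x) * D)
    lemma₂ = solve-∀ ℚ-ring
    expand = trans (weightedSum-+ (suc y) _ _) (cong (λ z → E + z) (trans (weightedSum-+ (suc y) _ _)
      (cong₂ _+_ (weightedSum-* (suc y) (2ℚ * deviation y) _) (weightedSum-* (suc y) (deviation y * deviation y) _))))

  energy≤1 : ∀ y → energy y ℚ.≤ 1ℚ
  energy≤1 y = ≤-trans (energy≤budget y) (≤-trans (weightedSum-mono y (λ {i} {j} _ → δ-level i j y)) (weightedSum-level y))

  -- A single term of the energy is at most 1, and multiplying by the reciprocal of its weight
  -- isolates the square.
  state²≤ : ∀ {y i j} → i ℕ.≤ j → j ℕ.< y → let J = ι (suc j) in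
            state y i j * state y i j ℚ.≤ J * J * J * (J * J * J) * ι (suc (suc j))
  state²≤ {y} {i} {j} i≤j j<y = subst₂ ℚ._≤_ (trans (lemma P w s²) (trans (cong (_* s²) (weight-ι⁶ j)) (*-identityˡ s²))) (*-identityʳ P)
    (*-monoˡ P (*-nonNeg (*-nonNeg J³ J³) (0≤ι (suc (suc j))))
      (≤-trans (weightedTerm≤ (λ i j → square-nonNeg (state y i j)) i≤j j<y) (energy≤1 y)))
    where
    J = ι (suc j)
    P = J * J * J * (J * J * J) * ι (suc (suc j))
    w = weight j
    s² = state y i j * state y i j
    J³ = *-nonNeg (*-nonNeg (0≤ι (suc j)) (0≤ι (suc j))) (0≤ι (suc j))
    lemma : ∀ P w s → P * (w * s) ≡ w * P * s
    lemma = solve-∀ ℚ-ring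

  -- With `J = ι (suc j)`, the square of `state y i j` is at most `J⁶ (1 + J)`, hence at most
  -- `2 J⁷`. If `2 K² ≤ J`, then `K²` times this is at most `J⁸`, the square of the level.
  discrepancy : ∀ K {y i j} → i ℕ.≤ j → j ℕ.< y → (K ℕ.+ K) ℕ.* K ℕ.≤ suc j →
                - ι (level j) ℚ.≤ ι K * state y i j × ι K * state y i j ℚ.≤ ι (level j)
  discrepancy K {y} {i} {j} i≤j j<y 2K²≤J =
    subst (- n ℚ.≤_) (neg-involutive (k * s)) (neg-antimono-≤ (square-cancel-≤ 0≤n (subst (ℚ._≤ n * n) (sym (neg-square (k * s))) square≤)))
    , square-cancel-≤ 0≤n square≤
    where
    k = ι K
    s = state y i j
    n = ι (level j)
    J = ι (suc j)
    0≤J = 0≤ι (suc j)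
    0≤J³ = *-nonNeg (*-nonNeg 0≤J 0≤J) 0≤J
    0≤n = 0≤ι (level j)
    neg-involutive : ∀ p → - (- p) ≡ p
    neg-involutive = solve-∀ ℚ-ring
    1≤J : 1ℚ ℚ.≤ J
    1≤J = ≤-by (ι j) (0≤ι j) refl
    2k²≤J : (k + k) * k ℚ.≤ J
    2k²≤J = subst (ℚ._≤ J) (trans (ι-* (K ℕ.+ K) K) (cong (_* k) (ι-+ K K))) (ι-mono 2K²≤J)
    lemma₁ : ∀ k s P → k * k * P ≡ k * s * (k * s) + k * k * (P - s * s)
    lemma₁ = solve-∀ ℚ-ring
    lemma₂ : ∀ k J → J * (J * (J * J)) * (J * (J * (J * J))) ≡
      k * k * (J * J * J * (J * J * J) * (1ℚ + J)) + (k * k * (J * J * J * (J * J * J)) * (J - 1ℚ) + J * J * J * (J * J * J) * J * (J - (k + k) * k))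
    lemma₂ = solve-∀ ℚ-ring
    square≤ : k * s * (k * s) ℚ.≤ n * n
    square≤ = ≤-trans
      (≤-by _ (*-nonNeg (square-nonNeg k) (gap (state²≤ i≤j j<y))) (lemma₁ k s _))
      (≤-by _ (+-nonNeg (*-nonNeg (*-nonNeg (square-nonNeg k) (*-nonNeg 0≤J³ 0≤J³)) (gap 1≤J))
                        (*-nonNeg (*-nonNeg (*-nonNeg 0≤J³ 0≤J³) 0≤J) (gap 2k²≤J)))
              (trans (cong₂ _*_ (ι-level j) (ι-level j)) (lemma₂ k J)))

-- Parity of the visits of a function

⟦_⟧ : Bool → ℚ
⟦ b ⟧ = if b then 1ℚ else 0ℚ

0≤⟦⟧ : ∀ b → 0ℚ ℚ.≤ ⟦ b ⟧
0≤⟦⟧ true  = 0≤1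
0≤⟦⟧ false = ≤-refl

⟦⟧≤1 : ∀ b → ⟦ b ⟧ ℚ.≤ 1ℚ
⟦⟧≤1 true  = ≤-refl
⟦⟧≤1 false = 0≤1

count-Σ : ∀ Z n → ι (count Z n) ≡ Σ n (λ x → ⟦ Z x ⟧)
count-Σ Z zero    = refl
count-Σ Z (suc n) = trans (ι-+ (indicator Z n) (count Z n))
  (trans (+-comm (ι (indicator Z n)) (ι (count Z n))) (cong₂ _+_ (count-Σ Z n) (ι-indicator (Z n))))
  where
  ι-indicator : ∀ b → ι (if b then 1 else 0) ≡ ⟦ b ⟧
  ι-indicator true  = refl
  ι-indicator false = refl

count-mono : ∀ Z {m n} → m ℕ.≤ n → count Z m ℕ.≤ count Z n
count-mono Z m≤n = go (ℕ.≤⇒≤′ m≤n)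
  where
  go : ∀ {m n} → m ℕ.≤′ n → count Z m ℕ.≤ count Z n
  go ℕ.≤′-refl                   = ℕ.≤-refl
  go {n = suc n} (ℕ.≤′-step m≤n) = ℕ.≤-trans (go m≤n) (ℕ.m≤n+m (count Z n) (indicator Z n))

≡ᵇ-refl : ∀ n → (n ℕ.≡ᵇ n) ≡ true
≡ᵇ-refl zero    = refl
≡ᵇ-refl (suc n) = ≡ᵇ-refl n

≢⇒≡ᵇ-false : ∀ m n → m ≢ n → (m ℕ.≡ᵇ n) ≡ false
≢⇒≡ᵇ-false m n m≢n with m ℕ.≡ᵇ n in eq
... | true  = contradiction (ℕ.≡ᵇ⇒≡ m n (subst Bool.T (sym eq) tt)) m≢n
... | false = refl

-- One unit per place pays for an initial segment where no estimate is available: the places before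
-- `j` that `δ` ignores, or those before a block.
Σ-except : ∀ j n {g h} → (∀ {y} → y ℕ.< j → g y ℚ.≤ 1ℚ + h y) → (∀ {y} → y ℕ.< n → j ℕ.≤ y → g y ℚ.≤ h y) →
           Σ n g ℚ.≤ ι j + Σ n h
Σ-except j zero _ _ = subst (0ℚ ℚ.≤_) (sym (+-identityʳ (ι j))) (0≤ι j)
Σ-except j (suc n) {g} {h} early late with suc n ℕ.≤? j
... | yes n<j = ≤-trans (Σ-mono (suc n) (λ y<1+n → early (ℕ.<-≤-trans y<1+n n<j)))
  (≤-trans (≤-reflexive (trans (Σ-+ (suc n) (λ _ → 1ℚ) h) (cong (_+ Σ (suc n) h) (trans (Σ-const (suc n) 1ℚ) (*-identityʳ (ι (suc n)))))))
           (+-monoˡ-≤ (Σ (suc n) h) (ι-mono n<j)))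
... | no n≮j = ≤-trans (+-mono-≤ (Σ-except j n early (λ y<n → late (ℕ.m<n⇒m<1+n y<n))) (late ℕ.≤-refl (ℕ.≮⇒≥ n≮j)))
  (≤-reflexive (+-assoc (ι j) (Σ n h) (h n)))

Σ-update : ∀ M {g h z} → z ℕ.< M → (∀ y → y ≢ z → h y ≡ g y) → Σ M h ≡ Σ M g + (h z - g z)
Σ-update (suc M) {g} {h} {z} z<1+M same with z ℕ.≟ M
... | yes refl = trans (cong (_+ h M) (prefix M ℕ.≤-refl)) (lemma (Σ M g) (g M) (h M))
  where
  prefix : ∀ m → m ℕ.≤ M → Σ m h ≡ Σ m g
  prefix zero    _   = refl
  prefix (suc m) m<M = cong₂ _+_ (prefix m (ℕ.<⇒≤ m<M)) (same m (ℕ.<⇒≢ m<M))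
  lemma : ∀ s a b → s + b ≡ s + a + (b - a)
  lemma = solve-∀ ℚ-ring
... | no z≢M = trans (cong₂ _+_ (Σ-update M (ℕ.≤∧≢⇒< (ℕ.m<1+n⇒m≤n z<1+M) z≢M) same) (same M (λ M≡z → z≢M (sym M≡z))))
  (lemma (Σ M g) (g M) (h z - g z))
  where
  lemma : ∀ s a d → s + d + a ≡ s + a + d
  lemma = solve-∀ ℚ-ring

module _ (f : ℕ → ℕ) where

  occursOdd-step-at : ∀ n → occursOdd f (suc n) (f n) ≡ not (occursOdd f n (f n))
  occursOdd-step-at n = trans (cong (occursOdd f n (f n) xor_) (≡ᵇ-refl (f n))) (Bool.xor-comm (occursOdd f n (f n)) true)

  occursOdd-step-off : ∀ n y → y ≢ f n → occursOdd f (suc n) y ≡ occursOdd f n y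
  occursOdd-step-off n y y≢fn = trans (cong (occursOdd f n y xor_) (≢⇒≡ᵇ-false (f n) y (λ e → y≢fn (sym e)))) (Bool.xor-identityʳ (occursOdd f n y))

  -- Each pair of occurrences of y among f 0, ..., f (n - 1) contributes one
  -- agreement, so only the unpaired last occurrences depend on A.

  agreement-parity : ∀ (A : Subset) M n → (∀ {x} → x ℕ.< n → f x ℕ.< M) →
    2ℚ * ι (count (agree (λ x → A (f x)) (alternating f)) n)
      ≡ ι n + Σ M (λ y → ⟦ occursOdd f n y ⟧ * (1ℚ - 2ℚ * ⟦ A y ⟧))
  agreement-parity A M zero _ = sym (cong (λ x → 0ℚ + x) (trans (Σ-cong M (λ y → *-zeroˡ (1ℚ - 2ℚ * ⟦ A y ⟧))) (trans (Σ-const M 0ℚ) (*-zeroʳ (ι M)))))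
  agreement-parity A M (suc n) f<M = begin
    2ℚ * ι (count Z (suc n))
      ≡⟨ cong (λ x → 2ℚ * x) (trans (count-Σ Z (suc n)) (cong (_+ ⟦ Z n ⟧) (sym (count-Σ Z n)))) ⟩
    2ℚ * (ι (count Z n) + ⟦ Z n ⟧)
      ≡⟨ *-distribˡ-+ 2ℚ (ι (count Z n)) ⟦ Z n ⟧ ⟩
    2ℚ * ι (count Z n) + 2ℚ * ⟦ Z n ⟧
      ≡⟨ cong₂ _+_ (agreement-parity A M n (λ x<n → f<M (ℕ.m<n⇒m<1+n x<n))) (new (A (f n)) (occursOdd f n (f n))) ⟩
    ι n + Σ M g + (1ℚ + (⟦ not (occursOdd f n (f n)) ⟧ * v (f n) - g (f n)))
      ≡⟨ lemma (ι n) (Σ M g) _ ⟩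
    1ℚ + ι n + (Σ M g + (⟦ not (occursOdd f n (f n)) ⟧ * v (f n) - g (f n)))
      ≡⟨ cong (λ b → 1ℚ + ι n + (Σ M g + (⟦ b ⟧ * v (f n) - g (f n)))) (sym (occursOdd-step-at n)) ⟩
    1ℚ + ι n + (Σ M g + (h (f n) - g (f n)))
      ≡⟨ cong (λ x → 1ℚ + ι n + x) (sym (Σ-update M (f<M ℕ.≤-refl) (λ y y≢fn → cong (λ b → ⟦ b ⟧ * v y) (occursOdd-step-off n y y≢fn)))) ⟩
    ι (suc n) + Σ M h
      ∎
    where
    open ≡-Reasoning
    Z : Subset
    Z = agree (λ x → A (f x)) (alternating f)
    v g h : ℕ → ℚ
    v y = 1ℚ - 2ℚ * ⟦ A y ⟧
    g y = ⟦ occursOdd f n y ⟧ * v y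
    h y = ⟦ occursOdd f (suc n) y ⟧ * v y
    -- If the parity `b` was even, the visit opens the term `1ℚ - 2ℚ * ⟦ a ⟧`; if it was odd, the
    -- visit removes that term again. So a pair of visits counts as exactly one agreement.
    new : ∀ a b → 2ℚ * ⟦ does (a Bool.≟ b) ⟧ ≡ 1ℚ + (⟦ not b ⟧ * (1ℚ - 2ℚ * ⟦ a ⟧) - ⟦ b ⟧ * (1ℚ - 2ℚ * ⟦ a ⟧))
    new true  true  = refl
    new true  false = refl
    new false true  = refl
    new false false = refl
    lemma : ∀ n s d → n + s + (1ℚ + d) ≡ 1ℚ + n + (s + d)
    lemma = solve-∀ ℚ-ring

  -- Each visit changes the parity at one place only. This bounds the number of unpaired values, and
  -- with it the budget of a requirement.
  occursOdd-total : ∀ n M → Σ M (λ y → ⟦ occursOdd f n y ⟧) ℚ.≤ ι n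
  occursOdd-total zero    M = ≤-reflexive (trans (Σ-const M 0ℚ) (*-zeroʳ (ι M)))
  occursOdd-total (suc n) M with f n ℕ.<? M
  ... | yes fn<M = ≤-trans
    (≤-reflexive (Σ-update M fn<M (λ y y≢fn → cong ⟦_⟧ (occursOdd-step-off n y y≢fn))))
    (≤-trans (+-mono-≤ (occursOdd-total n M) (difference≤1 (occursOdd f (suc n) (f n)) (occursOdd f n (f n)))) (≤-reflexive (+-comm (ι n) 1ℚ)))
    where
    difference≤1 : ∀ a b → ⟦ a ⟧ - ⟦ b ⟧ ℚ.≤ 1ℚ
    difference≤1 a b = ≤-by _ (+-nonNeg (gap (⟦⟧≤1 a)) (0≤⟦⟧ b)) (lemma ⟦ a ⟧ ⟦ b ⟧)
      where
      lemma : ∀ a b → 1ℚ ≡ a - b + (1ℚ - a + b)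
      lemma = solve-∀ ℚ-ring
  ... | no fn≮M = ≤-trans
    (Σ-mono M (λ {y} y<M → ≤-reflexive (cong ⟦_⟧ (occursOdd-step-off n y (λ { refl → fn≮M y<M })))))
    (≤-trans (occursOdd-total n M) (≤-by 1ℚ 0≤1 (+-comm 1ℚ (ι n))))

  strictBound : ℕ → ℕ
  strictBound zero    = 0
  strictBound (suc n) = strictBound n ℕ.+ suc (f n)

  <-strictBound : ∀ n {x} → x ℕ.< n → f x ℕ.< strictBound n
  <-strictBound (suc n) {x} x<1+n with x ℕ.≟ n
  ... | yes refl = ℕ.m≤n+m (suc (f n)) (strictBound n)
  ... | no x≢n   = ℕ.<-≤-trans (<-strictBound n (ℕ.≤∧≢⇒< (ℕ.m<1+n⇒m≤n x<1+n) x≢n)) (ℕ.m≤m+n (strictBound n) (suc (f n)))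

occursOdd-id-≥ : ∀ n {y} → n ℕ.≤ y → occursOdd (λ x → x) n y ≡ false
occursOdd-id-≥ zero    _   = refl
occursOdd-id-≥ (suc n) {y} n<y = trans (occursOdd-step-off (λ x → x) n y (λ y≡n → ℕ.<⇒≢ n<y (sym y≡n))) (occursOdd-id-≥ n (ℕ.<⇒≤ n<y))

-- Under the identity every place is visited once, so requirement 0 collects the deviations of all
-- places from `j` up to the level.
occursOdd-id-< : ∀ n {y} → y ℕ.< n → occursOdd (λ x → x) n y ≡ true
occursOdd-id-< (suc n) {y} y<1+n with y ℕ.≟ n
... | yes refl = trans (occursOdd-step-at (λ x → x) n) (cong not (occursOdd-id-≥ n ℕ.≤-refl))
... | no y≢n   = trans (occursOdd-step-off (λ x → x) n y y≢n) (occursOdd-id-< n (ℕ.≤∧≢⇒< (ℕ.m<1+n⇒m≤n y<1+n) y≢n))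

-- Growth of the levels and the Archimedean property

level-mono : ∀ {i j} → i ℕ.≤ j → level i ℕ.≤ level j
level-mono i≤j = ℕ.^-monoˡ-≤ 4 (ℕ.s≤s i≤j)

level-< : ∀ j → level j ℕ.< level (suc j)
level-< j = ℕ.^-monoˡ-< 4 (ℕ.n<1+n (suc j))

scaled-index≤level : ∀ K j → K ℕ.≤ suc j → K ℕ.* j ℕ.≤ level j
scaled-index≤level K j K≤J = ℕ.*-mono-≤ K≤J (ℕ.≤-trans (ℕ.n≤1+n j) (ℕ.m≤m*n (suc j) (suc j ℕ.^ 2) {{ℕ.m^n≢0 (suc j) 2}}))

-- The constant is 4 + 6 + 4 + 1, the sum of the lower binomial coefficients in the expansion of the
-- fourth power of `suc j + 1`.
level-step : ∀ j → level (suc j) ℕ.≤ level j ℕ.+ 15 ℕ.* suc j ℕ.^ 3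
level-step j = subst (level (suc j) ℕ.≤_) (sym (lemma j)) (ℕ.m≤m+n (level (suc j)) _)
  where
  lemma : ∀ j → ((1 ℕ.+ j) ℕ.* ((1 ℕ.+ j) ℕ.* ((1 ℕ.+ j) ℕ.* ((1 ℕ.+ j) ℕ.* 1)))) ℕ.+ 15 ℕ.* ((1 ℕ.+ j) ℕ.* ((1 ℕ.+ j) ℕ.* ((1 ℕ.+ j) ℕ.* 1))) ≡
    ((2 ℕ.+ j) ℕ.* ((2 ℕ.+ j) ℕ.* ((2 ℕ.+ j) ℕ.* ((2 ℕ.+ j) ℕ.* 1)))) ℕ.+ (17 ℕ.* j ℕ.+ 27 ℕ.* (j ℕ.* j) ℕ.+ 11 ℕ.* (j ℕ.* j ℕ.* j))
  lemma = ℕ-Solver.solve-∀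

-- Consecutive levels have ratio tending to 1, so that estimates at the levels carry over to all
-- numbers in between.
level-gap : ∀ K j {n} → K ℕ.* 15 ℕ.≤ suc j → n ℕ.< level (suc j) → ι K * (ι n - ι (level j)) ℚ.≤ ι (level j)
level-gap K j {n} 15K≤J n< = ≤-trans
  (*-monoˡ (ι K) (0≤ι K) (≤-by _ (gap (subst (ι n ℚ.≤_) (ι-+ (level j) e) (ι-mono (ℕ.≤-trans (ℕ.<⇒≤ n<) (level-step j))))) (lemma (ι n) (ι (level j)) (ι e))))
  (subst (ℚ._≤ ι (level j)) (ι-* K e) (ι-mono (ℕ.≤-trans (ℕ.≤-reflexive (sym (ℕ.*-assoc K 15 _))) (ℕ.*-monoˡ-≤ (suc j ℕ.^ 3) 15K≤J))))
  where
  e = 15 ℕ.* suc j ℕ.^ 3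
  lemma : ∀ n l e → e ≡ n - l + (l + e - n)
  lemma = solve-∀ ℚ-ring

level-bracket : ∀ n → ∃ λ j → level j ℕ.≤ suc n × suc n ℕ.< level (suc j)
level-bracket zero    = 0 , ℕ.≤-refl , ℕ.s≤s (ℕ.s≤s ℕ.z≤n)
level-bracket (suc n) with j , lj≤ , <lj+1 ← level-bracket n | suc (suc n) ℕ.<? level (suc j)
... | yes < = j , ℕ.≤-trans lj≤ (ℕ.n≤1+n (suc n)) , <
... | no ≮  = suc j , ℕ.≮⇒≥ ≮ , ℕ.≤-<-trans <lj+1 (level-< (suc j))

level-bracket-≥ : ∀ {i j n} → level i ℕ.≤ n → n ℕ.< level (suc j) → i ℕ.≤ j
level-bracket-≥ li≤n n<lj = ℕ.≮⇒≥ (λ j<i → ℕ.<⇒≱ n<lj (ℕ.≤-trans (level-mono j<i) li≤n))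

archimedean : ∀ ε → 0ℚ < ε → ∃ λ d → 1ℚ ℚ.≤ ι d * ε
archimedean ε@(mkℚ (+ suc n) d _) 0<ε = suc d , subst (1ℚ ℚ.≤_) (sym eq) (ι-mono {1} {suc n} (ℕ.s≤s ℕ.z≤n))
  where
  eq : ι (suc d) * ε ≡ ι (suc n)
  eq = trans (*-comm (ι (suc d)) ε) (trans (cong (_* ι (suc d)) (sym (↥p/↧p≡p ε))) (/-*-ι (suc n) d))
archimedean ε@(mkℚ (+ zero)   _ _) 0<ε with () ← ℤ.Positive.pos (positive 0<ε)
archimedean ε@(mkℚ -[1+ n ]   _ _) 0<ε with () ← ℤ.Positive.pos (positive 0<ε)

-- Rational approximation of p from below

half-split : ∀ h → ½ * h + ½ * h ≡ h
half-split = solve-∀ ℚ-ring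

width : ℕ → ℚ
width zero    = 1ℚ
width (suc y) = ½ * width y

0≤½ : 0ℚ ℚ.≤ ½
0≤½ = nonNegative⁻¹ ½

0≤width : ∀ y → 0ℚ ℚ.≤ width y
0≤width zero    = 0≤1
0≤width (suc y) = *-nonNeg 0≤½ (0≤width y)

width≤1 : ∀ y → width y ℚ.≤ 1ℚ
width≤1 zero    = ≤-refl
width≤1 (suc y) = ≤-by _ (+-nonNeg (*-nonNeg 0≤½ (gap (width≤1 y))) 0≤½) (lemma (width y))
  where
  lemma : ∀ w → 1ℚ ≡ ½ * w + (½ * (1ℚ - w) + ½)
  lemma = solve-∀ ℚ-ring

-- This makes the dyadic widths comparable with the reciprocals supplied by `archimedean`.
width-ι : ∀ y → width y * ι (suc y) ℚ.≤ 1ℚ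
width-ι zero    = ≤-reflexive refl
width-ι (suc y) = ≤-by _ (+-nonNeg (*-nonNeg 0≤½ (gap (width≤1 y))) (*-nonNeg 0≤½ (gap (width-ι y)))) (lemma (width y) (ι (suc y)))
  where
  lemma : ∀ w J → 1ℚ ≡ ½ * w * (1ℚ + J) + (½ * (1ℚ - w) + ½ * (1ℚ - w * J))
  lemma = solve-∀ ℚ-ring

module Approximation (em : ExcludedMiddle 0ℓ) (p : ℝ) (0≤p : fromℚ 0ℚ ≤ p) (p≤½ : p ≤ fromℚ ½) where

  refine : ∀ {P : Set} → Dec P → ℚ → ℚ → ℚ
  refine (yes _) a h = a + h
  refine (no _)  a h = a

  -- Greedy binary expansion of `p`: a digit is taken whenever the result stays strictly below `p`.
  approx : ℕ → ℚ
  approx zero    = 0ℚ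
  approx (suc y) = refine (em {approx y + width (suc y) ∈ below p}) (approx y) (width (suc y))

  0≤approx : ∀ y → 0ℚ ℚ.≤ approx y
  0≤approx zero    = ≤-refl
  0≤approx (suc y) with em {approx y + width (suc y) ∈ below p}
  ... | yes _ = +-nonNeg (0≤approx y) (0≤width (suc y))
  ... | no _  = 0≤approx y

  -- The first alternative covers `p = 0`, where no digit is ever taken and 0 is not strictly below
  -- `p`.
  approx-below : ∀ y → approx y ≡ 0ℚ ⊎ approx y ∈ below p
  approx-below zero    = inj₁ refl
  approx-below (suc y) with em {approx y + width (suc y) ∈ below p}
  ... | yes a∈ = inj₂ a∈
  ... | no _   = approx-below y

  approx+width∉ : ∀ y → approx y + width y ∉ below p
  approx+width∉ zero    1∈ = <-asym (p≤½ 1∈) (from-yes (½ <? 1ℚ))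
  approx+width∉ (suc y) with em {approx y + width (suc y) ∈ below p}
  ... | yes _ = subst (_∉ below p) (trans (cong (λ w → approx y + w) (sym (half-split (width y)))) (sym (+-assoc (approx y) (width (suc y)) (width (suc y))))) (approx+width∉ y)
  ... | no a∉ = a∉

  approx≤½ : ∀ y → approx y ℚ.≤ ½
  approx≤½ y with approx-below y
  ... | inj₁ a≡0 = subst (ℚ._≤ ½) (sym a≡0) 0≤½
  ... | inj₂ a∈  = <⇒≤ (p≤½ a∈)

  approx≤upper : ∀ {q} → q ∉ below p → ∀ y → approx y ℚ.≤ q
  approx≤upper {q} q∉ y with approx-below y
  ... | inj₁ a≡0 = subst (ℚ._≤ q) (sym a≡0) (≮⇒≥ (λ q<0 → q∉ (0≤p q<0)))
  ... | inj₂ a∈  = ≮⇒≥ (λ q<a → q∉ (downward p q<a a∈))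

  -- Since `approx y + width y` is not below `p` while `s` is, `approx y` is at least `s - width y`,
  -- and eventually the width is at most `s - r`.
  lower≤approx : ∀ {r s} → r < s → s ∈ below p → ∃ λ N → ∀ y → N ℕ.≤ y → r ℚ.≤ approx y
  lower≤approx {r} {s} r<s s∈ =
    let K , 1≤Kε = archimedean (s - r) (gap-< r<s) in K , λ y K≤y → bound y (≤-trans 1≤Kε (*-monoʳ-≤-nonNeg (s - r) {{nonNegative (gap (<⇒≤ r<s))}} (ι-mono (ℕ.m≤n⇒m≤1+n K≤y))))
    where
    gap-< : ∀ {p q} → p < q → 0ℚ < q - p
    gap-< {p} {q} p<q = subst (_< q - p) (+-inverseʳ p) (+-monoˡ-< (- p) p<q)
    bound : ∀ y → 1ℚ ℚ.≤ ι (suc y) * (s - r) → r ℚ.≤ approx y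
    bound y 1≤ = ≤-trans (≤-by _ (gap width≤) (lemma r s (width y))) (≤-by _ (gap s≤) (lemma′ (approx y) s (width y)))
      where
      width≤ : width y ℚ.≤ s - r
      width≤ = *-cancelʳ-≤-pos (ι (suc y)) {{positive (0<ι y)}} (≤-trans (width-ι y) (≤-trans 1≤ (≤-reflexive (*-comm (ι (suc y)) (s - r)))))
      s≤ : s ℚ.≤ approx y + width y
      s≤ = ≮⇒≥ (λ lt → approx+width∉ y (downward p lt s∈))
      lemma : ∀ r s w → s - w ≡ r + (s - r - w)
      lemma = solve-∀ ℚ-ring
      lemma′ : ∀ a s w → a ≡ s - w + (a + w - s)
      lemma′ = solve-∀ ℚ-ring

-- Diagonalization

-- Block k is [level (top k), level (top (k + 1))), where suc (top k) = (k + 1)!.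

top : ℕ → ℕ
top zero    = 0
top (suc k) = top k ℕ.+ suc k ℕ.* suc (top k)

top-< : ∀ k → top k ℕ.< top (suc k)
top-< k = ℕ.≤-trans (ℕ.m≤m+n (suc (top k)) (k ℕ.* suc (top k))) (ℕ.m≤n+m (suc k ℕ.* suc (top k)) (top k))

top-mono : ∀ {k m} → k ℕ.≤ m → top k ℕ.≤ top m
top-mono k≤m = go (ℕ.≤⇒≤′ k≤m)
  where
  go : ∀ {k m} → k ℕ.≤′ m → top k ℕ.≤ top m
  go ℕ.≤′-refl                   = ℕ.≤-refl
  go {m = suc m} (ℕ.≤′-step k≤m) = ℕ.≤-trans (go k≤m) (ℕ.<⇒≤ (top-< m))

k≤top : ∀ k → k ℕ.≤ top k
k≤top zero    = ℕ.z≤n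
k≤top (suc k) = ℕ.≤-<-trans (k≤top k) (top-< k)

-- Since `suc (top (suc k))` is `k + 2` times `suc (top k)`, one of the four factors of the level
-- already gains `K`. So the part before block `k` is negligible at its end.
level-top : ∀ K k → K ℕ.≤ k → K ℕ.* level (top k) ℕ.≤ level (top (suc k))
level-top K k K≤k = ℕ.≤-trans (ℕ.≤-reflexive (sym (ℕ.*-assoc K J (J ℕ.^ 3))))
  (ℕ.*-mono-≤ (ℕ.≤-trans (ℕ.*-monoˡ-≤ J (ℕ.m≤n⇒m≤1+n K≤k)) (ℕ.≤-trans (ℕ.m≤n+m (suc k ℕ.* J) (top k)) (ℕ.n≤1+n _)))
               (ℕ.^-monoˡ-≤ 3 (ℕ.s≤s (ℕ.<⇒≤ (top-< k)))))
  where J = suc (top k)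

InBlock : ℕ → ℕ → Set
InBlock k y = level (top k) ℕ.≤ y × y ℕ.< level (top (suc k))

InBlock-unique : ∀ {k m y} → InBlock k y → InBlock m y → k ≡ m
InBlock-unique {k} {m} (k≤y , y<k+1) (m≤y , y<m+1) with ℕ.<-cmp k m
... | tri≈ _ k≡m _ = k≡m
... | tri< k<m _ _ = contradiction (ℕ.≤-trans (level-mono (top-mono k<m)) m≤y) (ℕ.<⇒≱ y<k+1)
... | tri> _ _ m<k = contradiction (ℕ.≤-trans (level-mono (top-mono m<k)) k≤y) (ℕ.<⇒≱ y<m+1)

indicator-reflects : ∀ (R : Subset) y → indicator R y ≡ 1 → R y ≡ true
indicator-reflects R y eq with true ← R y = refl

index<level : ∀ j → j ℕ.< level j
index<level j = ℕ.m≤m*n (suc j) (suc j ℕ.^ 3) {{ℕ.m^n≢0 (suc j) 3}}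

frequency-ι : ∀ Z m → frequency Z m * ι (suc m) ≡ ι (count Z (suc m))
frequency-ι Z m = /-*-ι (count Z (suc m)) m

-- The constant 4 beats the three error terms, each at most `ι n`, that remain in both density
-- estimates after scaling by `ι K`.
archimedean-4 : ∀ {r s} → r < s → ∃ λ K → ι 4 ℚ.≤ ι K * (s - r)
archimedean-4 {r} {s} r<s =
  let d , 1≤dε = archimedean (s - r) (subst (_< s - r) (+-inverseʳ r) (+-monoˡ-< (- r) r<s))
  in 4 ℕ.* d , subst (ι 4 ℚ.≤_) (trans (sym (*-assoc (ι 4) (ι d) (s - r))) (cong (_* (s - r)) (sym (ι-* 4 d)))) (*-monoˡ (ι 4) (0≤ι 4) 1≤dε)

4≤x⇒xn≰3n : ∀ {n} x → 0ℚ < n → ι 4 ℚ.≤ x → ¬ (x * n ℚ.≤ ι 3 * n)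
4≤x⇒xn≰3n {n} x 0<n 4≤x xn≤3n = <-irrefl refl (<-≤-trans 0<n (≤-by _ (+-nonNeg (*-nonNeg (gap 4≤x) (<⇒≤ 0<n)) (gap xn≤3n)) (lemma n x)))
  where
  lemma : ∀ n a → 0ℚ ≡ n + ((a - ι 4) * n + (ι 3 * n - a * n))
  lemma = solve-∀ ℚ-ring

count-cong : ∀ {Z Z′ : Subset} → Z ≗ Z′ → ∀ n → count Z n ≡ count Z′ n
count-cong eq zero    = refl
count-cong eq (suc n) = cong₂ ℕ._+_ (cong (λ b → if b then 1 else 0) (eq n)) (count-cong eq n)

-- Construction of the set `A`

module Construction (em : ExcludedMiddle 0ℓ) (p : ℝ) (0≤p : fromℚ 0ℚ ≤ p) (p≤½ : p ≤ fromℚ ½) where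

  open Enumeration em
  open Approximation em p 0≤p p≤½

  diagonal : Subset
  diagonal y = does (em {∃ λ k → InBlock k y × φ k y ≡ 1})

  diagonal-block : ∀ {k y R} → φ k ≗ indicator R → InBlock k y → diagonal y ≡ R y
  diagonal-block {k} {y} {R} φ≗R y∈k with em {∃ λ k → InBlock k y × φ k y ≡ 1}
  ... | yes (m , y∈m , φ≡1) with refl ← InBlock-unique {k} {m} y∈k y∈m = sym (indicator-reflects R y (trans (sym (φ≗R y)) φ≡1))
  ... | no ∄ with R y in eq
  ...   | true  = contradiction (k , y∈k , trans (φ≗R y) (cong (λ b → if b then 1 else 0) eq)) ∄
  ...   | false = refl

  -- Requirement 0 keeps the agreement with the diagonal low; requirement i + 1
  -- keeps the agreement of alternating (φ i) with the preimage under φ i high.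

  reduction : ℕ → ℕ → ℕ
  reduction zero    = λ y → y
  reduction (suc i) = φ i

  -- Where `diagonal y` holds, agreement with the diagonal means membership in `A`, elsewhere it
  -- means nonmembership. The sign converts deviations of agreement into those of nonmembership, as
  -- `agreement-parity` needs.
  sign : ℕ → ℕ → ℚ
  sign zero    y = 1ℚ
  sign (suc i) y = if diagonal y then - 1ℚ else 1ℚ

  onlyIf : ∀ {P : Set} → Dec P → ℚ → ℚ
  onlyIf (yes _) q = q
  onlyIf (no _)  q = 0ℚ

  -- Cutting off the places before `j` lets the requirement enter the energy at time `j` with sum 0.
  δ : ℕ → ℕ → ℕ → ℚ
  δ i j y = onlyIf (j ℕ.≤? y) (sign i y * ⟦ occursOdd (reduction i) (level j) y ⟧)

  δ-early : ∀ i {j y} → y ℕ.< j → δ i j y ≡ 0ℚ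
  δ-early i {j} {y} y<j with j ℕ.≤? y
  ... | yes j≤y = contradiction j≤y (ℕ.<⇒≱ y<j)
  ... | no _    = refl

  δ-from : ∀ i {j y} → j ℕ.≤ y → δ i j y ≡ sign i y * ⟦ occursOdd (reduction i) (level j) y ⟧
  δ-from i {j} {y} j≤y with j ℕ.≤? y
  ... | yes _  = refl
  ... | no j≰y = contradiction j≤y j≰y

  sign² : ∀ i y → sign i y * sign i y ≡ 1ℚ
  sign² zero    y = refl
  sign² (suc i) y with diagonal y
  ... | true  = refl
  ... | false = refl

  δ²≤ : ∀ i j y → δ i j y * δ i j y ℚ.≤ ⟦ occursOdd (reduction i) (level j) y ⟧
  δ²≤ i j y with j ℕ.≤? y
  ... | no _  = 0≤⟦⟧ (occursOdd (reduction i) (level j) y)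
  ... | yes _ = ≤-reflexive (trans (lemma (sign i y) _) (trans (cong (_* (b * b)) (sign² i y)) (trans (*-identityˡ (b * b)) (⟦⟧-idem (occursOdd (reduction i) (level j) y)))))
    where
    b = ⟦ occursOdd (reduction i) (level j) y ⟧
    lemma : ∀ s b → s * b * (s * b) ≡ s * s * (b * b)
    lemma = solve-∀ ℚ-ring
    ⟦⟧-idem : ∀ b → ⟦ b ⟧ * ⟦ b ⟧ ≡ ⟦ b ⟧
    ⟦⟧-idem true  = refl
    ⟦⟧-idem false = refl

  open Balancing δ approx 0≤approx (λ y → ≤-trans (approx≤½ y) (≤-by ½ 0≤½ refl)) δ-early
    (λ i j y → ≤-trans (Σ-mono y (λ {x} _ → δ²≤ i j x)) (occursOdd-total (reduction i) (level j) y))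

  A : Subset
  A y = if choice y then diagonal y else not (diagonal y)

  agree-diagonal : ∀ y → agree A diagonal y ≡ choice y
  agree-diagonal y = lemma (choice y) (diagonal y)
    where
    lemma : ∀ c d → does ((if c then d else not d) Bool.≟ d) ≡ c
    lemma true  true  = refl
    lemma true  false = refl
    lemma false true  = refl
    lemma false false = refl

  -- Upper bound for `γ A`

  agreement-diagonal : ∀ {q} → (∀ y → approx y ℚ.≤ q) → ∀ j →
    ι (count (agree A diagonal) (level j)) ℚ.≤ ι j + (ι (level j) * q + state (level j) 0 j)
  agreement-diagonal {q} approx≤q j = begin
    ι (count (agree A diagonal) n)
      ≡⟨ trans (count-Σ (agree A diagonal) n) (Σ-cong n (λ y → cong ⟦_⟧ (agree-diagonal y))) ⟩
    Σ n (λ y → ⟦ choice y ⟧)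
      ≤⟨ Σ-except j n early late ⟩
    ι j + Σ n (λ y → q + δ 0 j y * deviation y)
      ≡⟨ cong (λ x → ι j + x) (trans (Σ-+ n (λ _ → q) (λ y → δ 0 j y * deviation y)) (cong₂ _+_ (Σ-const n q) (sym (state-Σ n 0 j)))) ⟩
    ι j + (ι n * q + state n 0 j)
      ∎
    where
    open ≤-Reasoning
    n = level j
    early : ∀ {y} → y ℕ.< j → ⟦ choice y ⟧ ℚ.≤ 1ℚ + (q + δ 0 j y * deviation y)
    early {y} y<j = ≤-trans (⟦⟧≤1 (choice y)) (≤-by q (≤-trans (0≤approx y) (approx≤q y))
      (trans (cong (λ d → 1ℚ + (q + d * deviation y)) (δ-early 0 y<j)) (lemma q (deviation y))))
      where
      lemma : ∀ q x → 1ℚ + (q + 0ℚ * x) ≡ 1ℚ + q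
      lemma = solve-∀ ℚ-ring
    late : ∀ {y} → y ℕ.< n → j ℕ.≤ y → ⟦ choice y ⟧ ℚ.≤ q + δ 0 j y * deviation y
    late {y} y<n j≤y = ≤-by _ (gap (approx≤q y))
      (trans (cong (λ d → q + d * deviation y) (trans (δ-from 0 j≤y) (cong (λ b → 1ℚ * ⟦ b ⟧) (occursOdd-id-< n y<n)))) (lemma q (approx y) ⟦ choice y ⟧))
      where
      lemma : ∀ q a c → q + 1ℚ * 1ℚ * (c - a) ≡ c + (q - a)
      lemma = solve-∀ ℚ-ring

  agreement-block : ∀ {k R} → φ k ≗ indicator R →
    ι (count (agree A R) (level (top (suc k)))) ℚ.≤ ι (level (top k)) + ι (count (agree A diagonal) (level (top (suc k))))
  agreement-block {k} {R} φ≗R = subst₂ (λ a b → a ℚ.≤ ι (level (top k)) + b)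
    (sym (count-Σ (agree A R) n)) (sym (count-Σ (agree A diagonal) n))
    (Σ-except (level (top k)) n
      (λ {y} _ → ≤-trans (⟦⟧≤1 (agree A R y)) (≤-by _ (0≤⟦⟧ (agree A diagonal y)) refl))
      (λ {y} y<n l≤y → ≤-reflexive (cong (λ b → ⟦ does (A y Bool.≟ b) ⟧) (sym (diagonal-block {k} {y} {R} φ≗R (l≤y , y<n))))))
    where n = level (top (suc k))

  -- The three errors at the end of block `k` are the places before the block, the `j` ignored
  -- places and the discrepancy; scaled by `ι K`, each is at most `ι n`.
  agreement-low : ∀ {q k R} K → φ k ≗ indicator R → (∀ y → approx y ℚ.≤ q) → (K ℕ.+ K) ℕ.* K ℕ.≤ k → K ℕ.≤ k →
    let n = level (top (suc k)) in
    ι K * ι (count (agree A R) n) ℚ.≤ ι K * q * ι n + ι 3 * ι n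
  agreement-low {q} {k} {R} K φ≗R approx≤q 2K²≤k K≤k = ≤-by _
    (+-nonNeg (*-nonNeg (0≤ι K) (+-nonNeg (gap (agreement-block {k} {R} φ≗R)) (gap (agreement-diagonal approx≤q j))))
      (+-nonNeg (gap Kl≤n) (+-nonNeg (gap Kj≤n) (gap (proj₂ (discrepancy K ℕ.z≤n (index<level j) (k≤J 2K²≤k)))))))
    (lemma (ι K) q (ι n) (ι (count (agree A R) n)) (ι (count (agree A diagonal) n)) (ι (level (top k))) (ι j) (state n 0 j))
    where
    j = top (suc k)
    n = level j
    k≤J : ∀ {m} → m ℕ.≤ k → m ℕ.≤ suc j
    k≤J m≤k = ℕ.≤-trans m≤k (ℕ.m≤n⇒m≤1+n (ℕ.<⇒≤ (k≤top (suc k))))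
    Kl≤n : ι K * ι (level (top k)) ℚ.≤ ι n
    Kl≤n = subst (ℚ._≤ ι n) (ι-* K (level (top k))) (ι-mono (level-top K k K≤k))
    Kj≤n : ι K * ι j ℚ.≤ ι n
    Kj≤n = subst (ℚ._≤ ι n) (ι-* K j) (ι-mono (scaled-index≤level K j (k≤J K≤k)))
    lemma : ∀ K q n c d l j s → K * q * n + ι 3 * n ≡ K * c + (K * (l + d - c + (j + (n * q + s) - d)) + (n - K * l + (n - K * j + (n - K * s))))
    lemma = solve-∀ ℚ-ring

  degree : ManyOneDegree
  degree = record { class = λ B → B ≡ₘ A ; rep = A ; class-def = λ B → mk⇔ (λ x → x) (λ x → x) }

  frequency-low : ∀ {q s k R N} K → q ∉ below p → ι 4 ℚ.≤ ι K * (s - q) →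
    N ℕ.+ ((K ℕ.+ K) ℕ.* K ℕ.+ K) ℕ.≤ k → φ k ≗ indicator R → ¬ (∀ i → s < frequency (agree A R) (N ℕ.+ i))
  frequency-low {q} {s} {k} {R} {N} K q∉p 4≤Kε big φ≗R s<freq = 4≤x⇒xn≰3n (ι K * (s - q)) 0<n 4≤Kε
    (≤-by _ (+-nonNeg (gap low) (*-nonNeg (0≤ι K) (gap high))) (lemma (ι K) q s (ι n) (ι (count (agree A R) n))))
    where
    n = level (top (suc k))
    N≤k = ℕ.≤-trans (ℕ.m≤m+n N _) big
    rest≤k = ℕ.≤-trans (ℕ.m≤n+m _ N) big
    low : ι K * ι (count (agree A R) n) ℚ.≤ ι K * q * ι n + ι 3 * ι n
    low = agreement-low {q} {k} {R} K φ≗R (approx≤upper q∉p) (ℕ.≤-trans (ℕ.m≤m+n _ K) rest≤k) (ℕ.≤-trans (ℕ.m≤n+m K ((K ℕ.+ K) ℕ.* K)) rest≤k)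
    k<n : suc k ℕ.≤ n
    k<n = ℕ.≤-trans (k≤top (suc k)) (ℕ.<⇒≤ (index<level (top (suc k))))
    -- `frequency Z m` refers to `[0, m + 1)`, so the end `n` of the block has index `n - 1`.
    m = ℕ.pred n
    1+m≡n : suc m ≡ n
    1+m≡n = ℕ.suc-pred n {{ℕ.>-nonZero (ℕ.<-≤-trans (ℕ.s≤s ℕ.z≤n) k<n)}}
    N≤m : N ℕ.≤ m
    N≤m = ℕ.≤-pred (ℕ.≤-trans (ℕ.s≤s N≤k) (subst (suc k ℕ.≤_) (sym 1+m≡n) k<n))
    0<n : 0ℚ < ι n
    0<n = subst (λ n → 0ℚ < ι n) 1+m≡n (0<ι m)
    high : s * ι n ℚ.≤ ι (count (agree A R) n)
    high = subst (λ n → s * ι n ℚ.≤ ι (count (agree A R) n)) 1+m≡n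
      (≤-trans (*-monoʳ-≤-nonNeg (ι (suc m)) {{nonNegative (0≤ι (suc m))}}
                 (<⇒≤ (subst (λ m → s < frequency (agree A R) m) (ℕ.m+[n∸m]≡n N≤m) (s<freq (m ℕ.∸ N)))))
               (≤-reflexive (frequency-ι (agree A R) m)))
    lemma : ∀ K q s n c → ι 3 * n ≡ K * (s - q) * n + (K * q * n + ι 3 * n - K * c + K * (c - s * n))
    lemma = solve-∀ ℚ-ring

  γA≤ : ∀ {q r} → q ∉ below p → q < r → r ∉ below (γ A)
  γA≤ {q} q∉p q<r ((R , R-comp) , N , s , r<s , s<freq) =
    let K , 4≤Kε = archimedean-4 (<-trans q<r r<s)
        k , big , φ≗R = φ-recurrent (indicator R) R-comp (N ℕ.+ ((K ℕ.+ K) ℕ.* K ℕ.+ K))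
    in frequency-low {q} {s} {k} {R} {N} K q∉p 4≤Kε big φ≗R s<freq

  Γ≤p : Γₘ degree ≤ p
  Γ≤p {q} (r , q<r , r∈γ) = decidable-stable em (λ q∉p → γA≤ q∉p q<r (r∈γ (A , rep≤ₘᵈ degree)))

  -- Lower bound for the preimages of `A`

  preimageAgreement : ℕ → Subset
  preimageAgreement i = agree (λ x → A (φ i x)) (alternating (φ i))

  -- Without its deviation, an unpaired place contributes `2ℚ * approx y - 1ℚ` off the diagonal set
  -- and `1ℚ - 2ℚ * approx y` on it. Both are at least `2ℚ * r - 1ℚ`, the second because `approx y`
  -- and `r` are at most `½`.
  unpaired-bound : ∀ {r} → r ℚ.≤ ½ → ∀ y b → r ℚ.≤ approx y →
    2ℚ * ((if diagonal y then - 1ℚ else 1ℚ) * ⟦ b ⟧ * deviation y) + (- (1ℚ - 2ℚ * r)) * ⟦ b ⟧ ℚ.≤ ⟦ b ⟧ * (1ℚ - 2ℚ * ⟦ A y ⟧)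
  unpaired-bound {r} r≤½ y b r≤π = go (choice y) (diagonal y) b
    where
    lemma₀ : ∀ s x c v → 0ℚ * v ≡ 2ℚ * (s * 0ℚ * x) + c * 0ℚ + 0ℚ
    lemma₀ = solve-∀ ℚ-ring
    lemma₁ : ∀ r a c → 1ℚ * (1ℚ - 2ℚ * c) ≡ 2ℚ * ((- 1ℚ) * 1ℚ * (c - a)) + (- (1ℚ - 2ℚ * r)) * 1ℚ + 2ℚ * (½ - a + (½ - r))
    lemma₁ = solve-∀ ℚ-ring
    lemma₂ : ∀ r a c → 1ℚ * (1ℚ - 2ℚ * (1ℚ - c)) ≡ 2ℚ * (1ℚ * 1ℚ * (c - a)) + (- (1ℚ - 2ℚ * r)) * 1ℚ + 2ℚ * (a - r)
    lemma₂ = solve-∀ ℚ-ring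
    ⟦not⟧ : ∀ c → ⟦ not c ⟧ ≡ 1ℚ - ⟦ c ⟧
    ⟦not⟧ true  = refl
    ⟦not⟧ false = refl
    select-true : ∀ c → (if c then true else false) ≡ c
    select-true true  = refl
    select-true false = refl
    select-false : ∀ c → (if c then false else true) ≡ not c
    select-false true  = refl
    select-false false = refl
    go : ∀ c d b →
      2ℚ * ((if d then - 1ℚ else 1ℚ) * ⟦ b ⟧ * (⟦ c ⟧ - approx y)) + (- (1ℚ - 2ℚ * r)) * ⟦ b ⟧
        ℚ.≤ ⟦ b ⟧ * (1ℚ - 2ℚ * ⟦ if c then d else not d ⟧)
    go c d false = ≤-by 0ℚ ≤-refl (lemma₀ (if d then - 1ℚ else 1ℚ) (⟦ c ⟧ - approx y) (- (1ℚ - 2ℚ * r)) (1ℚ - 2ℚ * ⟦ if c then d else not d ⟧))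
    go c true true = ≤-by _ (*-nonNeg 0≤2 (+-nonNeg (gap (approx≤½ y)) (gap r≤½)))
      (trans (cong (λ e → 1ℚ * (1ℚ - 2ℚ * ⟦ e ⟧)) (select-true c)) (lemma₁ r (approx y) ⟦ c ⟧))
    go c false true = ≤-by _ (*-nonNeg 0≤2 (gap r≤π))
      (trans (cong (λ e → 1ℚ * (1ℚ - 2ℚ * e)) (trans (cong ⟦_⟧ (select-false c)) (⟦not⟧ c))) (lemma₂ r (approx y) ⟦ c ⟧))

  module _ (i : ℕ) {r : ℚ} (r≤½ : r ℚ.≤ ½) where

    -- Each of the at most `level j` unpaired values costs at most `1ℚ - 2ℚ * r`, apart from its
    -- deviation, out of the total `level j` in `agreement-parity`; what is left is `2ℚ * r` times
    -- the level.
    agreement-preimage : ∀ j → (∀ y → j ℕ.≤ y → r ℚ.≤ approx y) → ∃ λ M → j ℕ.< M ×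
      2ℚ * state M (suc i) j + 2ℚ * r * ι (level j) ℚ.≤ ι j + 2ℚ * ι (count (preimageAgreement i) (level j))
    agreement-preimage j r≤π = M , ℕ.s≤s (ℕ.m≤m+n j (strictBound (φ i) n)) ,
      ≤-by _ (+-nonNeg (gap sums) (*-nonNeg 0≤1-2r (gap (occursOdd-total (φ i) n M))))
        (trans (cong (λ x → ι j + x) parity) (lemma (ι n) (ι j) r (state M (suc i) j) O H))
      where
      n = level j
      -- The first summand gives `j < M`, which `discrepancy` requires; the second bounds the
      -- visited values.
      M = suc j ℕ.+ strictBound (φ i) n
      odd : ℕ → Bool
      odd = occursOdd (φ i) n
      c = - (1ℚ - 2ℚ * r)
      O = Σ M (λ y → ⟦ odd y ⟧)
      h : ℕ → ℚ
      h y = ⟦ odd y ⟧ * (1ℚ - 2ℚ * ⟦ A y ⟧)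
      H = Σ M h
      parity : 2ℚ * ι (count (preimageAgreement i) n) ≡ ι n + H
      parity = agreement-parity (φ i) A M n (λ x<n → ℕ.<-≤-trans (<-strictBound (φ i) n x<n) (ℕ.m≤n+m (strictBound (φ i) n) (suc j)))
      0≤1-2r : 0ℚ ℚ.≤ 1ℚ - 2ℚ * r
      0≤1-2r = subst (0ℚ ℚ.≤_) (double r) (*-nonNeg 0≤2 (gap r≤½))
        where
        double : ∀ r → 2ℚ * (½ - r) ≡ 1ℚ - 2ℚ * r
        double = solve-∀ ℚ-ring
      lemma : ∀ n j r s o h → j + (n + h) ≡ 2ℚ * s + 2ℚ * r * n + (j + h - (2ℚ * s + (- (1ℚ - 2ℚ * r)) * o) + (1ℚ - 2ℚ * r) * (n - o))
      lemma = solve-∀ ℚ-ring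
      early : ∀ {y} → y ℕ.< j → 2ℚ * (δ (suc i) j y * deviation y) + c * ⟦ odd y ⟧ ℚ.≤ 1ℚ + h y
      early {y} y<j = subst (λ d → 2ℚ * (d * deviation y) + c * ⟦ odd y ⟧ ℚ.≤ 1ℚ + h y) (sym (δ-early (suc i) y<j))
        (≤-by _ (+-nonNeg (*-nonNeg 0≤1-2r (0≤⟦⟧ (odd y))) (1+bv≥0 (odd y) (A y))) (early-lemma (deviation y) ((1ℚ - 2ℚ * r)) ⟦ odd y ⟧ (h y)))
        where
        early-lemma : ∀ x c b h → 1ℚ + h ≡ 2ℚ * (0ℚ * x) + (- c) * b + (c * b + (1ℚ + h))
        early-lemma = solve-∀ ℚ-ring
        1+bv≥0 : ∀ b a → 0ℚ ℚ.≤ 1ℚ + ⟦ b ⟧ * (1ℚ - 2ℚ * ⟦ a ⟧)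
        1+bv≥0 true  true  = ≤-refl
        1+bv≥0 true  false = 0≤2
        1+bv≥0 false true  = 0≤1
        1+bv≥0 false false = 0≤1
      late : ∀ {y} → y ℕ.< M → j ℕ.≤ y → 2ℚ * (δ (suc i) j y * deviation y) + c * ⟦ odd y ⟧ ℚ.≤ h y
      late {y} _ j≤y = subst (λ d → 2ℚ * (d * deviation y) + c * ⟦ odd y ⟧ ℚ.≤ h y) (sym (δ-from (suc i) j≤y))
        (unpaired-bound r≤½ y (odd y) (r≤π y j≤y))
      sums : 2ℚ * state M (suc i) j + c * O ℚ.≤ ι j + H
      sums = subst (ℚ._≤ ι j + H)
        (trans (Σ-+ M (λ y → 2ℚ * (δ (suc i) j y * deviation y)) (λ y → c * ⟦ odd y ⟧))
          (cong₂ _+_ (trans (Σ-* M 2ℚ (λ y → δ (suc i) j y * deviation y)) (cong (λ x → 2ℚ * x) (sym (state-Σ M (suc i) j))))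
                     (Σ-* M c (λ y → ⟦ odd y ⟧))))
        (Σ-except j M early late)

    agreement-high-level : ∀ K j → suc i ℕ.≤ j → (K ℕ.+ K) ℕ.* K ℕ.≤ suc j → K ℕ.≤ suc j → (∀ y → j ℕ.≤ y → r ℚ.≤ approx y) →
      ι K * r * ι (level j) - 2ℚ * ι (level j) ℚ.≤ ι K * ι (count (preimageAgreement i) (level j))
    agreement-high-level K j i<j 2K²≤J K≤J r≤π =
      let M , j<M , G≥ = agreement-preimage j r≤π
      in ≤-by _
           (*-nonNeg 0≤½ (+-nonNeg (*-nonNeg (0≤ι K) (gap G≥))
             (+-nonNeg (*-nonNeg 0≤2 (gap (proj₁ (discrepancy K i<j j<M 2K²≤J)))) (+-nonNeg (gap Kj≤n) (0≤ι n)))))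
           (lemma (ι K) r (ι n) (ι j) (state M (suc i) j) (ι (count (preimageAgreement i) n)))
      where
      n = level j
      Kj≤n : ι K * ι j ℚ.≤ ι n
      Kj≤n = subst (ℚ._≤ ι n) (ι-* K j) (ι-mono (scaled-index≤level K j K≤J))
      lemma : ∀ K r n j s G → K * G ≡ K * r * n - 2ℚ * n +
        ½ * (K * (j + 2ℚ * G - (2ℚ * s + 2ℚ * r * n)) + (2ℚ * (K * s - (- n)) + (n - K * j + n)))
      lemma = solve-∀ ℚ-ring

    -- Passing from `level j` to `n` forfeits at most the places in between; by `level-gap` this is
    -- the third error of size `ι n`.
    agreement-high-between : ∀ K j₀ → suc i ℕ.≤ j₀ → (K ℕ.+ K) ℕ.* K ℕ.≤ j₀ → K ℕ.* 15 ℕ.≤ j₀ → (∀ y → j₀ ℕ.≤ y → r ℚ.≤ approx y) →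
      ∀ j n → j₀ ℕ.≤ j → level j ℕ.≤ n → n ℕ.< level (suc j) →
      ι K * r * ι n - ι 3 * ι n ℚ.≤ ι K * ι (count (preimageAgreement i) n)
    agreement-high-between K j₀ i<j₀ 2K²≤j₀ 15K≤j₀ r≤π j n j₀≤j l≤n n<l = ≤-by _
      (+-nonNeg (gap high) (+-nonNeg (*-nonNeg (0≤ι K) (gap (ι-mono (count-mono Z l≤n))))
        (+-nonNeg (*-nonNeg (*-nonNeg (0≤ι K) (gap (ι-mono l≤n))) (gap (≤-trans r≤½ ½≤1)))
          (+-nonNeg (gap (level-gap K j (to-J 15K≤j₀) n<l)) (*-nonNeg (0≤ι 3) (gap (ι-mono l≤n)))))))
      (lemma (ι K) r (ι n) (ι (level j)) (ι (count Z (level j))) (ι (count Z n)))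
      where
      Z = preimageAgreement i
      to-J : ∀ {a} → a ℕ.≤ j₀ → a ℕ.≤ suc j
      to-J a≤ = ℕ.≤-trans a≤ (ℕ.m≤n⇒m≤1+n j₀≤j)
      ½≤1 : ½ ℚ.≤ 1ℚ
      ½≤1 = ≤-by ½ 0≤½ refl
      high : ι K * r * ι (level j) - 2ℚ * ι (level j) ℚ.≤ ι K * ι (count Z (level j))
      high = agreement-high-level K j (ℕ.≤-trans i<j₀ j₀≤j) (to-J 2K²≤j₀) (to-J (ℕ.≤-trans (ℕ.m≤m*n K 15) 15K≤j₀))
        (λ y j≤y → r≤π y (ℕ.≤-trans j₀≤j j≤y))
      lemma : ∀ K r n l g G → K * G ≡ K * r * n - ι 3 * n +
        (K * g - (K * r * l - 2ℚ * l) + (K * (G - g) + (K * (n - l) * (1ℚ - r) + (l - K * (n - l) + ι 3 * (n - l)))))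
      lemma = solve-∀ ℚ-ring

    agreement-high : ∀ K j₀ → suc i ℕ.≤ j₀ → (K ℕ.+ K) ℕ.* K ℕ.≤ j₀ → K ℕ.* 15 ℕ.≤ j₀ → (∀ y → j₀ ℕ.≤ y → r ℚ.≤ approx y) →
      ∀ m → level j₀ ℕ.≤ suc m →
      ι K * r * ι (suc m) - ι 3 * ι (suc m) ℚ.≤ ι K * ι (count (preimageAgreement i) (suc m))
    agreement-high K j₀ i<j₀ 2K²≤j₀ 15K≤j₀ r≤π m l≤m =
      let j , l≤n , n<l = level-bracket m
      in agreement-high-between K j₀ i<j₀ 2K²≤j₀ 15K≤j₀ r≤π j (suc m) (level-bracket-≥ l≤m n<l) l≤n n<l

  frequency-high : ∀ {b c d} i → b < c → c < d → d ∈ below p → ∃ λ N → ∀ k → b < frequency (preimageAgreement i) (N ℕ.+ k)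
  frequency-high {b} {c} {d} i b<c c<d d∈p =
    let K , 4≤Kε = archimedean-4 b<c
        N₀ , c≤π  = lower≤approx c<d d∈p
        -- The sum of all thresholds: the requirement is in force, the discrepancy and the level gap
        -- are small, and `approx` has passed `c`.
        j₀ = suc i ℕ.+ ((K ℕ.+ K) ℕ.* K ℕ.+ (K ℕ.* 15 ℕ.+ N₀))
        2K²≤ = ℕ.≤-trans (ℕ.m≤m+n ((K ℕ.+ K) ℕ.* K) _) (ℕ.m≤n+m _ (suc i))
        rest≤ = ℕ.≤-trans (ℕ.m≤n+m (K ℕ.* 15 ℕ.+ N₀) ((K ℕ.+ K) ℕ.* K)) (ℕ.m≤n+m _ (suc i))
        high = agreement-high i (<⇒≤ (p≤½ (downward p c<d d∈p))) K j₀ (ℕ.m≤m+n (suc i) _) 2K²≤ (ℕ.≤-trans (ℕ.m≤m+n (K ℕ.* 15) N₀) rest≤)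
                 (λ y j₀≤y → c≤π y (ℕ.≤-trans (ℕ.≤-trans (ℕ.m≤n+m N₀ (K ℕ.* 15)) rest≤) j₀≤y))
    in level j₀ , λ k → exceeds K 4≤Kε (level j₀ ℕ.+ k) (high (level j₀ ℕ.+ k) (ℕ.m≤n⇒m≤1+n (ℕ.m≤m+n (level j₀) k)))
    where
    Z = preimageAgreement i
    exceeds : ∀ K → ι 4 ℚ.≤ ι K * (c - b) → ∀ m → ι K * c * ι (suc m) - ι 3 * ι (suc m) ℚ.≤ ι K * ι (count Z (suc m)) → b < frequency Z m
    exceeds K 4≤Kε m high = ≰⇒> λ freq≤b → 4≤x⇒xn≰3n (ι K * (c - b)) (0<ι m) 4≤Kε
      (≤-by _ (+-nonNeg (gap high) (*-nonNeg (0≤ι K) (gap (G≤ freq≤b)))) (lemma (ι K) b c (ι (suc m)) (ι (count Z (suc m)))))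
      where
      G≤ : frequency Z m ℚ.≤ b → ι (count Z (suc m)) ℚ.≤ b * ι (suc m)
      G≤ freq≤b = ≤-trans (≤-reflexive (sym (frequency-ι Z m))) (*-monoʳ-≤-nonNeg (ι (suc m)) {{nonNegative (0≤ι (suc m))}} freq≤b)
      lemma : ∀ K b c n G → ι 3 * n ≡ K * (c - b) * n + (K * G - (K * c * n - ι 3 * n) + K * (b * n - G))
      lemma = solve-∀ ℚ-ring

  frequency-preimage : ∀ {B f} i → (∀ x → B x ≡ A (f x)) → φ i ≗ f → ∀ m →
    frequency (preimageAgreement i) m ≡ frequency (agree B (alternating (φ i))) m
  frequency-preimage {B} {f} i B≡A∘f φ≗f m = cong (λ n → + n / suc m)
    (count-cong (λ x → cong (λ b → does (b Bool.≟ alternating (φ i) x)) (trans (cong A (φ≗f x)) (sym (B≡A∘f x)))) (suc m))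

  ∈γ-preimage : ∀ {a b c d B} → a < b → b < c → c < d → d ∈ below p → B ≤ₘ A → a ∈ below (γ B)
  ∈γ-preimage {a} {b} {B = B} a<b b<c c<d d∈p (f , (e , e⇓f) , B≡A∘f) =
    let i , _ , φ≗f = φ-recurrent f (e , e⇓f) 0
        N , b<freq  = frequency-high i b<c c<d d∈p
    in (alternating (φ i) , alternating-computable (φ i) (e , λ x → subst (e [ x ∷ [] ]⇓_) (sym (φ≗f x)) (e⇓f x)))
       , N , b , a<b , λ k → subst (b <_) (frequency-preimage {B} {f} i B≡A∘f φ≗f (N ℕ.+ k)) (b<freq k)

  p≤Γ : p ≤ Γₘ degree
  p≤Γ q∈p =
    -- Four steps of room: `a` for the infimum over all reducible sets, `b` for the tail infimum,
    -- `c` to absorb the errors in the frequency, and `d` for the convergence of `approx`.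
    let a , q<a , a∈p = rounded p q∈p
        b , a<b , b∈p = rounded p a∈p
        c , b<c , c∈p = rounded p b∈p
        d , c<d , d∈p = rounded p c∈p
    in a , q<a , λ (B , C , (C≤A , _) , B≤C) → ∈γ-preimage {B = B} a<b b<c c<d d∈p (≤ₘ-trans {B} {C} {A} B≤C C≤A)

theorem1p8 : ExcludedMiddle 0ℓ →
    (p : ℝ) → fromℚ 0ℚ ≤ p → p ≤ fromℚ ½ →
    ∃ λ (a : ManyOneDegree) → Γₘ a ≃ p
theorem1p8 em p 0≤p p≤½ = degree , Γ≤p , p≤Γ
  where open Construction em p 0≤p p≤½
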